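{- Let $w^0\in\mathcal{F}(\mathbb{P},\mathbb{R})$ be a post-fixpoint of $F^{\mathcal{R}}$, i.e. $F^{\mathcal{R}}(w^0)\leq_{\mathcal{F}}w^0$, and let $(w^k)_{k\geq 0}$ be the sequence generated from $w^0$ by the policy iteration algorithm. The following statements hold: 1. For all $k\in\mathbb{N}$, $w^k\in\mathcal{F}(\mathbb{P},\mathbb{R})$ and $F^{\mathcal{R}}(w^k)\leq_{\mathcal{F}}w^k$; 2. The sequence $(w^k)_{k\geq 0}$ is decreasing (i.e. $w^{k+1}\leq_{\mathcal{F}}w^k$ for all $k$) and converges; 3. Let $w^\infty=\lim_{k\to+\infty}w^k$; then $F^{\mathcal{R}}(w^\infty)\leq_{\mathcal{F}}w^\infty$. Furthermore, if $w^k\in\mathcal{FS}(\mathbb{P},\overline{\mathbb{R}})$ for all $k\in\mathbb{N}$ and $w^\infty\in\mathcal{FS}(\mathbb{P},\overline{\mathbb{R}})$, then $F^{\mathcal{R}}(w^\infty)=w^\infty$.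
   Context: System. A basic semi-algebraic set of $\mathbb{R}^d$ is a set of the form $\{x\in\mathbb{R}^d\mid r_j(x)\Join 0,\ j=1,\ldots,n\}$ with finitely many real polynomials $r_j$, where each $\Join$ is either $<$ or $\leq$. We are given: a nonempty compact basic semi-algebraic set $X^{\mathrm{in}}$ described by polynomials $r^{\mathrm{in}}=(r^{\mathrm{in}}_1,\ldots,r^{\mathrm{in}}_{n_{\mathrm{in}}})$; a basic semi-algebraic set $X^0$ described by $r^0=(r^0_1,\ldots,r^0_{n_0})$; a finite index set $\mathcal{I}$ and basic semi-algebraic sets $X^i$ ($i\in\mathcal{I}$), described by $r^i=(r^i_1,\ldots,r^i_{n_i})$, pairwise disjoint with $\bigcup_{i\in\mathcal{I}}X^i=\mathbb{R}^d$; and polynomial maps $T^i:\mathbb{R}^d\to\mathbb{R}^d$ ($i\in\mathcal{I}$), with $\deg T^i$ the maximal degree of the components. Templates. $\mathbb{P}$ is a given finite set of real polynomials in $d$ variables of degree at most $2m$ (templates). $\mathcal{F}(\mathbb{P},\overline{\mathbb{R}})$, $\mathcal{F}(\mathbb{P},\mathbb{R})$ and $\mathcal{F}(\mathbb{P},\mathbb{R}_+)$ are the sets of functions from $\mathbb{P}$ to $\overline{\mathbb{R}}=\mathbb{R}\cup\{\pm\infty\}$, resp. to $\mathbb{R}$, resp. to the nonnegative reals. $v\leq_{\mathcal{F}}w$ iff $v(p)\leq w(p)$ for all $p\in\mathbb{P}$; least fixpoints (in the complete lattice $\mathcal{F}(\mathbb{P},\overline{\mathbb{R}})$) refer to this order.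 Convergence in $\mathcal{F}(\mathbb{P},\mathbb{R})$ is pointwise. Relaxed functional. $\Sigma[x]$ is the set of sums of squares of real polynomials in $x=(x_1,\ldots,x_d)$; $\Sigma[x]^n$ is the set of $n$-tuples of such polynomials; $\langle\mu,r\rangle=\sum_l\mu_l r_l$. For $w\in\mathcal{F}(\mathbb{P},\overline{\mathbb{R}})$, $p\in\mathbb{P}$, $i\in\mathcal{I}$, $F_i^{\mathcal{R}}(w)(p)\in\overline{\mathbb{R}}$ is the infimum of $\eta$ over all $\eta\in\mathbb{R}$, $\lambda\in\mathcal{F}(\mathbb{P},\mathbb{R}_+)$, $\sigma\in\Sigma[x]$, $\mu\in\Sigma[x]^{n_i}$, $\gamma\in\Sigma[x]^{n_0}$ such that $$\eta-p\circ T^i-\sum_{q\in\mathbb{P}}\lambda(q)(w(q)-q)+\langle\mu,r^i\rangle+\langle\gamma,r^0\rangle=\sigma$$ as polynomials, $\deg\sigma\leq 2m\deg T^i$ and $\deg(\langle\mu,r^i\rangle+\langle\gamma,r^0\rangle)\leq 2m\deg T^i$ (with $\inf\emptyset=+\infty$). Conventions for infinite values: $0\cdot(\pm\infty)=0$ and $(+\infty)+(-\infty)=+\infty$ in sums $\sum_q\lambda(q)w(q)$; the displayed constraint is regarded as violated if this sum is $+\infty$ and as satisfied (for every $\eta$) if it is $-\infty$. For $p\in\mathbb{P}$, ${X^{\mathrm{in}}}^{\mathcal{R}}(p)$ is the infimum of $\eta\in\mathbb{R}$ such that $\eta-p+\langle\nu,r^{\mathrm{in}}\rangle=\sigma_0$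 for some $\sigma_0\in\Sigma[x]$, $\nu\in\Sigma[x]^{n_{\mathrm{in}}}$ with $\deg\sigma_0\leq 2m$ and $\deg\langle\nu,r^{\mathrm{in}}\rangle\leq 2m$. Finally $F^{\mathcal{R}}(w)(p)=\sup\{\sup_{i\in\mathcal{I}}F_i^{\mathcal{R}}(w)(p),\ {X^{\mathrm{in}}}^{\mathcal{R}}(p)\}$. Policies. For $w\in\mathcal{F}(\mathbb{P},\overline{\mathbb{R}})$, $\mathrm{Sol}(w,i,p)$ is the set of $(\lambda,\sigma,\mu,\gamma)\in\mathcal{F}(\mathbb{P},\mathbb{R}_+)\times\Sigma[x]\times\Sigma[x]^{n_i}\times\Sigma[x]^{n_0}$ satisfying $\deg\sigma\leq 2m\deg T^i$, $\deg(\langle\mu,r^i\rangle+\langle\gamma,r^0\rangle)\leq 2m\deg T^i$ and, as an identity of real polynomials (so that $F_i^{\mathcal{R}}(w)(p)$ and all $\lambda(q)w(q)$ are finite), $$F_i^{\mathcal{R}}(w)(p)=p\circ T^i+\sum_{q\in\mathbb{P}}\lambda(q)(w(q)-q)-\langle\mu,r^i\rangle-\langle\gamma,r^0\rangle+\sigma.$$ $\mathcal{FS}(\mathbb{P},\overline{\mathbb{R}})=\{w\in\mathcal{F}(\mathbb{P},\overline{\mathbb{R}})\mid\mathrm{Sol}(w,i,p)\neq\emptyset\ \forall i\in\mathcal{I},\forall p\in\mathbb{P}\}$. A policy is a map $\pi$ assigning to each $w\in\mathcal{FS}(\mathbb{P},\overline{\mathbb{R}})$ and $(i,p)\in\mathcal{I}\times\mathbb{P}$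 an element $\pi(w)(i,p)\in\mathrm{Sol}(w,i,p)$; $\pi_\lambda(w)(i,p)$ denotes the first component $\lambda$ of $\pi(w)(i,p)$. For $w\in\mathcal{FS}(\mathbb{P},\overline{\mathbb{R}})$ and $\lambda=\pi_\lambda(w)(i,p)$, put $$\phi_{w,i,p}^{\lambda}(v)=\sum_{q\in\mathbb{P}}\lambda(q)v(q)+F_i^{\mathcal{R}}(w)(p)-\sum_{q\in\mathbb{P}}\lambda(q)w(q)\qquad(v\in\mathcal{F}(\mathbb{P},\overline{\mathbb{R}})),$$ with the same conventions for infinite values, and define $\Phi_w^{\pi(w)}:\mathcal{F}(\mathbb{P},\overline{\mathbb{R}})\to\mathcal{F}(\mathbb{P},\overline{\mathbb{R}})$ by $$\Phi_w^{\pi(w)}(v)(p)=\sup\Big\{\sup_{i\in\mathcal{I}}\phi_{w,i,p}^{\pi_\lambda(w)(i,p)}(v),\ {X^{\mathrm{in}}}^{\mathcal{R}}(p)\Big\}.$$ Policy iteration algorithm. Input: a post-fixpoint $w^0\in\mathcal{F}(\mathbb{P},\mathbb{R})$ of $F^{\mathcal{R}}$. At step $k$: if $w^k$ is a fixpoint ($F^{\mathcal{R}}(w^k)=w^k$) or $w^k\notin\mathcal{FS}(\mathbb{P},\overline{\mathbb{R}})$, the algorithm stops, and one sets $w^l=w^k$ for all $l\geq k$. Otherwise, choose any policy $\pi$ (i.e. any elements $\pi(w^k)(i,p)\in\mathrm{Sol}(w^k,i,p)$), let $w^{k+1}$ be the least fixpoint of $\Phi_{w^k}^{\pi(w^k)}$,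 and continue with $k+1$. -}

module Defs where

open import Algebra.Bundles using (CommutativeRing; RawSemiring; Semiring)
import Algebra.Construct.NaturalChoice.Max as Max
import Algebra.Definitions.RawSemiring as RawSemiringOps
open import Axiom.ExcludedMiddle using (ExcludedMiddle)
open import Data.Bool using (if_then_else_)
open import Data.Empty using (⊥)
open import Data.Fin using (Fin)
open import Data.List using (List; []; _∷_; _++_)
import Data.List as List
open import Data.List.Extrema.Nat using (max)
open import Data.List.Relation.Unary.Any using (Any)
open import Data.Nat as ℕ using (ℕ; suc)
open import Data.Product using (Σ; Σ-syntax; ∃; ∃-syntax; _×_; _,_; proj₁; proj₂)
open import Data.Sum using (_⊎_)
open import Data.Unit using (⊤)
open import Data.Vec using (Vec; lookup; replicate; zipWith)
import Data.Vec as Vec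
open import Data.Vec.Functional as Vector using (Vector)
open import Data.Vec.Properties using (≡-dec)
open import Level using (0ℓ)
open import Relation.Binary.Bundles using (TotalOrder)
open import Relation.Binary.Core using (Rel)
import Relation.Binary.Construct.Add.Extrema.Equality as ExtremaEquality
import Relation.Binary.Construct.Add.Extrema.NonStrict as ExtremaOrder
import Relation.Binary.Construct.NonStrictToStrict as Strict
open import Relation.Binary.PropositionalEquality using (_≡_; _≢_)
open import Relation.Binary.Structures using (IsTotalOrder)
open import Relation.Nullary using (¬_; yes; no; does; contradiction)
open import Relation.Nullary.Construct.Add.Extrema using (_±; ⊥±; ⊤±; [_])
open import Relation.Unary using (Pred)

-- The standard library has no real numbers.  They enter through their
-- axiomatic characterisation, which (classically) determines them up to
-- isomorphism: a Dedekind-complete totally ordered field.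

record CompleteOrderedField : Set₁ where
  infix 4 _≤_ _<_
  field
    commutativeRing : CommutativeRing 0ℓ 0ℓ
  open CommutativeRing commutativeRing public
  field
    _≤_          : Rel Carrier 0ℓ
    isTotalOrder : IsTotalOrder _≈_ _≤_
    0≉1          : ¬ 0# ≈ 1#
    inverse      : ∀ x → ¬ x ≈ 0# → ∃[ y ] x * y ≈ 1#
    +-monoʳ-≤    : ∀ z {x y} → x ≤ y → z + x ≤ z + y
    *-nonneg     : ∀ {x y} → 0# ≤ x → 0# ≤ y → 0# ≤ x * y
    complete     : (S : Pred Carrier 0ℓ) → ∃ S →
                   ∃[ b ] (∀ x → S x → x ≤ b) →
                   ∃[ s ] (∀ x → S x → x ≤ s) ×
                          (∀ u → (∀ x → S x → x ≤ u) → s ≤ u)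

  _<_ : Rel Carrier 0ℓ
  _<_ = Strict._<_ _≈_ _≤_

module Analysis (R : CompleteOrderedField) (em : ExcludedMiddle 0ℓ) where

  open CompleteOrderedField R public renaming (Carrier to ℝ)
  open Semiring semiring public using (rawSemiring)

  open ExtremaEquality _≈_ public using (_≈±_)
  open ExtremaOrder _≤_ public
    using (_≤±_; ≤±-isTotalOrder; ⊥±≤_; _≤⊤±)

  private module ≤± = ExtremaOrder _≤_

  ℝ± : Set
  ℝ± = ℝ ±

  ≤±-totalOrder : TotalOrder 0ℓ 0ℓ 0ℓ
  ≤±-totalOrder = record { isTotalOrder = ≤±-isTotalOrder isTotalOrder }

  open Max ≤±-totalOrder public using (_⊔_)

  sup± : ∀ {n} → Vector ℝ± n → ℝ±
  sup± = Vector.foldr _⊔_ ⊥±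

  infixl 6 _+±_
  infixr 7 _·±_

  _+±_ : ℝ± → ℝ± → ℝ±
  ⊤±    +± _     = ⊤±
  ⊥±    +± ⊤±    = ⊤±
  ⊥±    +± ⊥±    = ⊥±
  ⊥±    +± [ _ ] = ⊥±
  [ _ ] +± ⊤±    = ⊤±
  [ _ ] +± ⊥±    = ⊥±
  [ x ] +± [ y ] = [ x + y ]

  -±_ : ℝ± → ℝ±
  -± ⊤±    = ⊥±
  -± ⊥±    = ⊤±
  -± [ x ] = [ - x ]

  -- Only used with a nonnegative first argument; 0 · (±∞) = 0.
  _·±_ : ℝ → ℝ± → ℝ±
  a ·± [ x ] = [ a * x ]
  a ·± ⊤±    = if does (em {P = a ≈ 0#}) then [ 0# ] else ⊤±
  a ·± ⊥±    = if does (em {P = a ≈ 0#}) then [ 0# ] else ⊥±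

  sum± : ∀ {n} → Vector ℝ± n → ℝ±
  sum± = Vector.foldr _+±_ [ 0# ]

  LowerBound : Pred ℝ 0ℓ → Pred ℝ 0ℓ
  LowerBound S l = ∀ x → S x → l ≤ x

  IsInfimum : Pred ℝ 0ℓ → Pred ℝ± 0ℓ
  IsInfimum S y = (∀ x → S x → y ≤± [ x ]) ×
                  (∀ z → (∀ x → S x → z ≤± [ x ]) → z ≤± y)

  infimum : (S : Pred ℝ 0ℓ) → ∃ (IsInfimum S)
  infimum S with em {P = ∃ S}
  ... | no ¬∃S = ⊤± , (λ x x∈S → contradiction (x , x∈S) ¬∃S) , λ z _ → z ≤⊤±
  ... | yes (x₀ , x₀∈S) with em {P = ∃ (LowerBound S)}
  ...   | no unbounded = ⊥± , (λ x _ → ⊥±≤ [ x ]) , greatest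
    where
    greatest : ∀ z → (∀ x → S x → z ≤± [ x ]) → z ≤± ⊥±
    greatest ⊥±    _ = ⊥±≤ ⊥±
    greatest [ l ] h =
      contradiction (l , λ x x∈S → ≤±.[≤]-injective (h x x∈S)) unbounded
    greatest ⊤±    h with () ← h x₀ x₀∈S
  ...   | yes bounded
      with complete (LowerBound S) bounded (x₀ , λ l l≤S → l≤S x₀ x₀∈S)
  ...     | s , upper , least =
        [ s ]
      , (λ x x∈S → ≤±.[ least x (λ l l≤S → l≤S x x∈S) ])
      , greatest
    where
    greatest : ∀ z → (∀ x → S x → z ≤± [ x ]) → z ≤± [ s ]
    greatest ⊥±    _ = ⊥±≤ [ s ]
    greatest [ l ] h = ≤±.[ upper l (λ x x∈S → ≤±.[≤]-injective (h x x∈S)) ]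
    greatest ⊤±    h with () ← h x₀ x₀∈S

  inf : Pred ℝ 0ℓ → ℝ±
  inf S = proj₁ (infimum S)

  Monomial : ℕ → Set
  Monomial d = Vec ℕ d

  -- A formal sum Σ c·xᵅ of terms (c , α).  A monomial may occur several
  -- times; polynomials are identified when all their coefficients agree.
  Poly : ℕ → Set
  Poly d = List (ℝ × Monomial d)

  coeff : ∀ {d} → Poly d → Monomial d → ℝ
  coeff []            α = 0#
  coeff ((c , β) ∷ p) α =
    if does (≡-dec ℕ._≟_ β α) then c + coeff p α else coeff p α

  infix  4 _≈ₚ_
  infixl 6 _+ₚ_ _-ₚ_
  infixl 7 _*ₚ_
  infix  8 -ₚ_

  _≈ₚ_ : ∀ {d} → Rel (Poly d) 0ℓ
  p ≈ₚ q = ∀ α → coeff p α ≈ coeff q α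

  const : ∀ {d} → ℝ → Poly d
  const c = (c , replicate _ 0) ∷ []

  _+ₚ_ _*ₚ_ : ∀ {d} → Poly d → Poly d → Poly d
  _+ₚ_ = _++_
  _*ₚ_ = List.cartesianProductWith
           λ (a , α) (b , β) → a * b , zipWith ℕ._+_ α β

  -ₚ_ : ∀ {d} → Poly d → Poly d
  -ₚ_ = List.map λ (c , α) → - c , α

  _-ₚ_ : ∀ {d} → Poly d → Poly d → Poly d
  p -ₚ q = p +ₚ (-ₚ q)

  polySemiring : ℕ → RawSemiring 0ℓ 0ℓ
  polySemiring d = record
    { Carrier = Poly d ; _≈_ = _≈ₚ_
    ; _+_ = _+ₚ_ ; _*_ = _*ₚ_ ; 0# = [] ; 1# = const 1#
    }

  sumₚ : ∀ {d n} → Vector (Poly d) n → Poly d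
  sumₚ {d} = RawSemiringOps.sum (polySemiring d)

  module _ (A : RawSemiring 0ℓ 0ℓ) (ι : ℝ → RawSemiring.Carrier A) where
    private
      module A = RawSemiring A
      open RawSemiringOps A using (product; _^_)

    substitute : ∀ {d} → Vector A.Carrier d → Poly d → A.Carrier
    substitute a = List.foldr
      (λ (c , α) s → (ι c A.* product (λ j → a j ^ lookup α j)) A.+ s) A.0#

  Point : ℕ → Set
  Point d = Vector ℝ d

  PolyMap : ℕ → Set
  PolyMap d = Vector (Poly d) d

  eval : ∀ {d} → Poly d → Point d → ℝ
  eval p x = substitute rawSemiring (λ c → c) x p

  _∘ₚ_ : ∀ {d} → Poly d → PolyMap d → Poly d
  _∘ₚ_ {d} p T = substitute (polySemiring d) const T p

  -- The zero polynomial gets degree 0.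
  deg : ∀ {d} → Poly d → ℕ
  deg p = max 0 (List.map Vec.sum
    (List.filter (λ α → em {P = ¬ coeff p α ≈ 0#}) (List.map proj₂ p)))

  degMap : ∀ {d} → PolyMap d → ℕ
  degMap T = max 0 (List.tabulate λ j → deg (T j))

  IsSOS : ∀ {d} → Pred (Poly d) 0ℓ
  IsSOS {d} σ = Σ[ qs ∈ List (Poly d) ]
    σ ≈ₚ List.foldr (λ q s → q *ₚ q +ₚ s) [] qs

  ⟨_,_⟩ : ∀ {d n} → Vector (Poly d) n → Vector (Poly d) n → Poly d
  ⟨ μ , r ⟩ = sumₚ λ l → μ l *ₚ r l

  Ball : ∀ {d} → Point d → ℝ → Pred (Point d) 0ℓ
  Ball x ε y = ∀ j → x j - y j < ε × y j - x j < ε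

  IsOpen : ∀ {d} → Pred (Pred (Point d) 0ℓ) 0ℓ
  IsOpen U = ∀ x → U x → ∃[ ε ] 0# < ε × (∀ y → Ball x ε y → U y)

  IsCompact : ∀ {d} → Pred (Point d) 0ℓ → Set₁
  IsCompact {d} X =
    (J : Set) (U : J → Pred (Point d) 0ℓ) → (∀ j → IsOpen (U j)) →
    (∀ x → X x → ∃[ j ] U j x) →
    Σ[ js ∈ List J ] (∀ x → X x → Any (λ j → U j x) js)

  data Comparison : Set where
    lt le : Comparison

  _⟦_⟧0 : ℝ → Comparison → Set
  a ⟦ lt ⟧0 = a < 0#
  a ⟦ le ⟧0 = a ≤ 0#

  record BasicSemialgebraic (d : ℕ) : Set where
    field
      size    : ℕ
      poly    : Vector (Poly d) size
      compare : Vector Comparison size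

    Member : Pred (Point d) 0ℓ
    Member x = ∀ j → eval (poly j) x ⟦ compare j ⟧0

  open BasicSemialgebraic using (size; poly; Member)

  record System (d : ℕ) : Set₁ where
    field
      Xin          : BasicSemialgebraic d
      Xin-nonempty : ∃ (Member Xin)
      Xin-compact  : IsCompact (Member Xin)
      X⁰           : BasicSemialgebraic d
      |I|          : ℕ
      X            : Fin |I| → BasicSemialgebraic d
      X-disjoint   : ∀ {i j} → i ≢ j → ∀ x → Member (X i) x → ¬ Member (X j) x
      X-cover      : ∀ x → ∃[ i ] Member (X i) x
      T            : Fin |I| → PolyMap d

  record Templates (d m : ℕ) : Set where
    field
      |P|      : ℕ
      template : Vector (Poly d) |P|
      distinct : ∀ {p q} → template p ≈ₚ template q → p ≡ q
      bounded  : ∀ p → deg (template p) ℕ.≤ 2 ℕ.* m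

  module PolicyIteration {d m} (sys : System d) (tpl : Templates d m) where

    open System sys public
    open Templates tpl public

    I P : Set
    I = Fin |I|
    P = Fin |P|

    𝓕 𝓕ℝ : Set
    𝓕  = P → ℝ±
    𝓕ℝ = P → ℝ

    embed : 𝓕ℝ → 𝓕
    embed u p = [ u p ]

    infix 4 _≤𝓕_ _≈𝓕_

    _≤𝓕_ _≈𝓕_ : Rel 𝓕 0ℓ
    v ≤𝓕 w = ∀ p → v p ≤± w p
    v ≈𝓕 w = ∀ p → v p ≈± w p

    IsReal : Pred 𝓕 0ℓ
    IsReal w = Σ[ u ∈ 𝓕ℝ ] w ≈𝓕 embed u

    -- A term w k p that is ±∞ is at distance ≥ ε from l p.
    Converges : (ℕ → 𝓕) → 𝓕ℝ → Set
    Converges w l = ∀ p ε → 0# < ε → ∃[ N ] ∀ k → N ℕ.≤ k →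
      ∃[ x ] w k p ≈± [ x ] × x - l p < ε × l p - x < ε

    combine : 𝓕ℝ → 𝓕 → ℝ±
    combine λ′ w = sum± λ q → λ′ q ·± w q

    combineₚ : 𝓕ℝ → Poly d
    combineₚ λ′ = sumₚ λ q → const (λ′ q) *ₚ template q

    record Multipliers (i : I) : Set where
      field
        λ′    : 𝓕ℝ
        λ′≥0  : ∀ q → 0# ≤ λ′ q
        σ     : Poly d
        σ-sos : IsSOS σ
        μ     : Vector (Poly d) (size (X i))
        μ-sos : ∀ l → IsSOS (μ l)
        γ     : Vector (Poly d) (size X⁰)
        γ-sos : ∀ l → IsSOS (γ l)

        deg-σ : deg σ ℕ.≤ 2 ℕ.* m ℕ.* degMap (T i)
        deg-r : deg (⟨ μ , poly (X i) ⟩ +ₚ ⟨ γ , poly X⁰ ⟩)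
                  ℕ.≤ 2 ℕ.* m ℕ.* degMap (T i)

    -- s stands for Σ λ(q) w(q), so that const s -ₚ combineₚ λ′ is
    -- Σ λ(q)(w(q) - q), here and in Identity.  The constraint fails when
    -- s = +∞ and holds for every η when s = -∞.
    Constraint : (i : I) → P → Multipliers i → ℝ → ℝ± → Set
    Constraint i p M η = λ where
        ⊤±    → ⊥
        ⊥±    → ⊤
        [ s ] → const η -ₚ (template p ∘ₚ T i) -ₚ (const s -ₚ combineₚ λ′)
                  +ₚ (⟨ μ , poly (X i) ⟩ +ₚ ⟨ γ , poly X⁰ ⟩) ≈ₚ σ
      where open Multipliers M

    F_i : I → 𝓕 → 𝓕
    F_i i w p = inf λ η → Σ[ M ∈ Multipliers i ]
      Constraint i p M η (combine (Multipliers.λ′ M) w)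

    Xinᴿ : 𝓕
    Xinᴿ p = inf λ η →
      Σ[ σ₀ ∈ Poly d ] Σ[ ν ∈ Vector (Poly d) (size Xin) ]
        IsSOS σ₀ × (∀ l → IsSOS (ν l)) ×
        deg σ₀ ℕ.≤ 2 ℕ.* m × deg ⟨ ν , poly Xin ⟩ ℕ.≤ 2 ℕ.* m ×
        const η -ₚ template p +ₚ ⟨ ν , poly Xin ⟩ ≈ₚ σ₀

    F : 𝓕 → 𝓕
    F w p = sup± (λ i → F_i i w p) ⊔ Xinᴿ p

    Identity : (i : I) → P → Multipliers i → ℝ± → ℝ± → Set
    Identity i p M [ c ] [ s ] =
        const c ≈ₚ (template p ∘ₚ T i) +ₚ (const s -ₚ combineₚ λ′)
                     -ₚ ⟨ μ , poly (X i) ⟩ -ₚ ⟨ γ , poly X⁰ ⟩ +ₚ σ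
      where open Multipliers M
    Identity i p M _ _ = ⊥

    Sol : 𝓕 → I → P → Set
    Sol w i p = Σ[ M ∈ Multipliers i ]
      Identity i p M (F_i i w p) (combine (Multipliers.λ′ M) w)

    FS : Pred 𝓕 0ℓ
    FS w = ∀ i p → Sol w i p

    Policy : Set
    Policy = ∀ w → FS w → ∀ i p → Sol w i p

    -- Used only for w in FS, where the last two summands are finite.
    φ : 𝓕 → I → P → 𝓕ℝ → 𝓕 → ℝ±
    φ w i p λ′ v = combine λ′ v +± F_i i w p +± -± combine λ′ w

    Φ : Policy → (w : 𝓕) → FS w → 𝓕 → 𝓕
    Φ π w w∈FS v p = sup± (λ i → φ w i p (πλ i) v) ⊔ Xinᴿ p
      where
      πλ : I → 𝓕ℝ
      πλ i = Multipliers.λ′ (proj₁ (π w w∈FS i p))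

    IsFixpoint : (𝓕 → 𝓕) → Pred 𝓕 0ℓ
    IsFixpoint f w = f w ≈𝓕 w

    IsLeastFixpoint : (𝓕 → 𝓕) → Pred 𝓕 0ℓ
    IsLeastFixpoint f w = IsFixpoint f w × (∀ v → IsFixpoint f v → w ≤𝓕 v)

    Stops : Pred 𝓕 0ℓ
    Stops w = IsFixpoint F w ⊎ ¬ FS w

    -- Least fixpoints and limits are relations, so a run is any sequence of
    -- iterates compatible with the algorithm, for any choice of policies.
    record IsRun (w⁰ : 𝓕ℝ) (w : ℕ → 𝓕) : Set where
      field
        start   : w 0 ≈𝓕 embed w⁰
        stop    : ∀ k → Stops (w k) → ∀ l → k ℕ.≤ l → w l ≈𝓕 w k
        improve : ∀ k → ¬ Stops (w k) →
                  Σ[ w∈FS ∈ FS (w k) ] Σ[ π ∈ Policy ]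
                    IsLeastFixpoint (Φ π (w k) w∈FS) (w (suc k))

{-# OPTIONS --safe #-}

-- A multiplier M certifying η as an upper bound in F_i(w)(p) also certifies
-- η + Σ λ(q)(v(q) − w(q)) for every real v, with the same σ, μ and γ.  Hence
-- F is monotone on real functions, and the affine maps φ attached to a
-- solution at w dominate F_i and touch it at w, so that F ≤ Φ_w and
-- Φ_w(w) = F(w).  By Knaster–Tarski the least fixpoint w′ of Φ_w lies below
-- the post-fixpoint w, so F(w′) ≤ Φ_w(w′) = w′ ≤ F(w); it is real because
-- evaluating the certificates at a point x of X^in gives p(x) ≤ X^in(p).
-- The iterates decrease and are bounded below, so they converge.  The
-- multipliers at w∞ give limsup F(w^k) ≤ F(w∞), whence w∞ ≤ F(w∞).

module Submission where

open import Defs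
open import Axiom.ExcludedMiddle using (ExcludedMiddle)
open import Data.Nat using (ℕ; suc)
open import Data.Product using (_×_; ∃-syntax)
open import Level using (0ℓ)

import Algebra.Definitions.RawSemiring as RawSemiringOps
import Algebra.Construct.NaturalChoice.Max as Max
import Algebra.Properties.AbelianGroup as AbelianGroupProperties
import Algebra.Properties.CommutativeSemigroup as CommutativeSemigroupProperties
import Algebra.Properties.Ring as RingProperties
import Algebra.Properties.Semiring.Exp as Exp
import Algebra.Properties.Semiring.Sum as Sum
import Algebra.Solver.CommutativeMonoid as CommutativeMonoidSolver
open import Data.Fin using (Fin; zero; suc)
open import Data.List using (List; []; _∷_)
import Data.List as List
import Data.List.Properties as List
open import Data.Nat as ℕ using (zero; s≤s)
import Data.Nat.Properties as ℕ
open import Data.Product using (∃; _,_; proj₁; proj₂; Σ-syntax)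
open import Data.Sum using (inj₁; inj₂)
open import Data.Vec using ([]; _∷_; lookup; replicate; zipWith)
open import Data.Vec.Functional using (Vector)
open import Data.Vec.Properties using (≡-dec)
open import Function using (_∘_)
open import Relation.Binary.Bundles using (TotalOrder)
import Relation.Binary.Construct.Add.Extrema.Equality as ExtremaEquality
import Relation.Binary.Construct.Add.Extrema.NonStrict as ExtremaOrder
import Relation.Binary.Construct.Add.Supremum.NonStrict as SupremumOrder
open import Relation.Binary.PropositionalEquality as ≡ using (_≡_; _≢_)
import Relation.Binary.Reasoning.PartialOrder as PartialOrderReasoning
import Relation.Binary.Reasoning.Setoid as SetoidReasoning
open import Relation.Nullary using (¬_; yes; no; contradiction)
open import Relation.Nullary.Construct.Add.Extrema using (⊥±; ⊤±; [_])
open import Relation.Nullary.Decidable using (¬?)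
open import Relation.Unary using (Pred)

-- Order arithmetic in a totally ordered field.

module OrderedFieldProperties (R : CompleteOrderedField) where

  open CompleteOrderedField R hiding (zero) renaming (Carrier to ℝ)
  open AbelianGroupProperties +-abelianGroup
    using (//-rightDividesˡ; //-rightDividesʳ; ⁻¹-involutive; ε⁻¹≈ε)
  open RingProperties ring using (-‿distribˡ-*; -‿distribʳ-*; x[y-z]≈xy-xz)
  open Sum semiring using (sum; sum-cong-≋; *-distribʳ-sum; ∑-distrib-+)

  totalOrder : TotalOrder 0ℓ 0ℓ 0ℓ
  totalOrder = record { isTotalOrder = isTotalOrder }

  open TotalOrder totalOrder public
    using (poset; ≤-respˡ-≈; ≤-respʳ-≈)
    renaming (refl to ≤-refl; trans to ≤-trans; antisym to ≤-antisym;
              reflexive to ≤-reflexive; total to ≤-total)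

  module ≈-Reasoning = SetoidReasoning setoid
  module ≤-Reasoning = PartialOrderReasoning poset

  <⇒≱ : ∀ {x y} → x < y → ¬ y ≤ x
  <⇒≱ (x≤y , x≉y) y≤x = x≉y (≤-antisym x≤y y≤x)

  <-respˡ-≈ : ∀ {x y z} → x ≈ y → x < z → y < z
  <-respˡ-≈ x≈y (x≤z , x≉z) = ≤-respˡ-≈ x≈y x≤z , λ y≈z → x≉z (trans x≈y y≈z)

  ≰⇒> : ∀ {x y} → ¬ x ≤ y → y < x
  ≰⇒> {x} {y} x≰y with ≤-total x y
  ... | inj₁ x≤y = contradiction x≤y x≰y
  ... | inj₂ y≤x = y≤x , λ y≈x → x≰y (≤-reflexive (sym y≈x))

  +-monoˡ-≤ : ∀ z {x y} → x ≤ y → x + z ≤ y + z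
  +-monoˡ-≤ z {x} {y} x≤y = begin
    x + z ≈⟨ +-comm x z ⟩
    z + x ≤⟨ +-monoʳ-≤ z x≤y ⟩
    z + y ≈⟨ +-comm z y ⟩
    y + z ∎
    where open ≤-Reasoning

  +-mono-≤ : ∀ {x y u v} → x ≤ y → u ≤ v → x + u ≤ y + v
  +-mono-≤ {y = y} {u} x≤y u≤v = ≤-trans (+-monoˡ-≤ u x≤y) (+-monoʳ-≤ y u≤v)

  x-z≤y⇒x≤y+z : ∀ {x y z} → x - z ≤ y → x ≤ y + z
  x-z≤y⇒x≤y+z {x} {y} {z} x-z≤y =
    ≤-respˡ-≈ (//-rightDividesˡ z x) (+-monoˡ-≤ z x-z≤y)

  x≤y+z⇒x-z≤y : ∀ {x y z} → x ≤ y + z → x - z ≤ y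
  x≤y+z⇒x-z≤y {x} {y} {z} x≤y+z =
    ≤-respʳ-≈ (//-rightDividesʳ z y) (+-monoˡ-≤ (- z) x≤y+z)

  x+z≤y⇒x≤y-z : ∀ {x y z} → x + z ≤ y → x ≤ y - z
  x+z≤y⇒x≤y-z {x} {y} {z} x+z≤y =
    ≤-respˡ-≈ (//-rightDividesʳ z x) (+-monoˡ-≤ (- z) x+z≤y)

  x≤y-z⇒x+z≤y : ∀ {x y z} → x ≤ y - z → x + z ≤ y
  x≤y-z⇒x+z≤y {x} {y} {z} x≤y-z =
    ≤-respʳ-≈ (//-rightDividesˡ z y) (+-monoˡ-≤ z x≤y-z)

  +-cancelʳ-≤ : ∀ z {x y} → x + z ≤ y + z → x ≤ y
  +-cancelʳ-≤ z {x} {y} x+z≤y+z =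
    ≤-respʳ-≈ (//-rightDividesʳ z y) (x+z≤y⇒x≤y-z x+z≤y+z)

  x≤y⇒0≤y-x : ∀ {x y} → x ≤ y → 0# ≤ y - x
  x≤y⇒0≤y-x {x} x≤y = ≤-respˡ-≈ (-‿inverseʳ x) (+-monoˡ-≤ (- x) x≤y)

  0≤y-x⇒x≤y : ∀ {x y} → 0# ≤ y - x → x ≤ y
  0≤y-x⇒x≤y {x} {y} 0≤y-x = begin
    x            ≈⟨ +-identityˡ x ⟨
    0# + x       ≤⟨ +-monoˡ-≤ x 0≤y-x ⟩
    (y - x) + x  ≈⟨ //-rightDividesˡ x y ⟩
    y            ∎
    where open ≤-Reasoning

  x<y⇒0<y-x : ∀ {x y} → x < y → 0# < y - x
  x<y⇒0<y-x {x} {y} x<y =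
    x≤y⇒0≤y-x (proj₁ x<y) , λ 0≈y-x → <⇒≱ x<y (begin
      y            ≈⟨ //-rightDividesˡ x y ⟨
      (y - x) + x  ≈⟨ +-congʳ 0≈y-x ⟨
      0# + x       ≈⟨ +-identityˡ x ⟩
      x            ∎)
    where open ≤-Reasoning

  neg-antimono-≤ : ∀ {x y} → x ≤ y → - y ≤ - x
  neg-antimono-≤ {x} {y} x≤y = 0≤y-x⇒x≤y (begin
    0#         ≤⟨ x≤y⇒0≤y-x x≤y ⟩
    y - x      ≈⟨ +-comm y (- x) ⟩
    - x + y    ≈⟨ +-congˡ (⁻¹-involutive y) ⟨
    - x - - y  ∎)
    where open ≤-Reasoning

  *-monoˡ-≤ : ∀ {a x y} → 0# ≤ a → x ≤ y → a * x ≤ a * y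
  *-monoˡ-≤ {a} {x} {y} 0≤a x≤y = 0≤y-x⇒x≤y
    (≤-respʳ-≈ (x[y-z]≈xy-xz a y x) (*-nonneg 0≤a (x≤y⇒0≤y-x x≤y)))

  *-monoʳ-≤ : ∀ {a x y} → 0# ≤ a → x ≤ y → x * a ≤ y * a
  *-monoʳ-≤ {a} {x} {y} 0≤a x≤y =
    ≤-respˡ-≈ (*-comm a x) (≤-respʳ-≈ (*-comm a y) (*-monoˡ-≤ 0≤a x≤y))

  square-nonneg : ∀ x → 0# ≤ x * x
  square-nonneg x with ≤-total 0# x
  ... | inj₁ 0≤x = *-nonneg 0≤x 0≤x
  ... | inj₂ x≤0 = begin
    0#            ≤⟨ *-nonneg 0≤-x 0≤-x ⟩
    - x * - x     ≈⟨ -‿distribˡ-* x (- x) ⟨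
    - (x * - x)   ≈⟨ -‿cong (-‿distribʳ-* x x) ⟨
    - - (x * x)   ≈⟨ ⁻¹-involutive (x * x) ⟩
    x * x         ∎
    where
    open ≤-Reasoning
    0≤-x : 0# ≤ - x
    0≤-x = ≤-respˡ-≈ ε⁻¹≈ε (neg-antimono-≤ x≤0)

  0≤1 : 0# ≤ 1#
  0≤1 = ≤-respʳ-≈ (*-identityʳ 1#) (square-nonneg 1#)

  1≰0 : ¬ 1# ≤ 0#
  1≰0 = <⇒≱ (0≤1 , 0≉1)

  1+nonneg≉0 : ∀ {a} → 0# ≤ a → ¬ 1# + a ≈ 0#
  1+nonneg≉0 {a} 0≤a 1+a≈0 = 1≰0 (begin
    1#      ≈⟨ +-identityʳ 1# ⟨
    1# + 0# ≤⟨ +-monoʳ-≤ 1# 0≤a ⟩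
    1# + a  ≈⟨ 1+a≈0 ⟩
    0#      ∎)
    where open ≤-Reasoning

  -- Dividing by `1# + a` rather than `a` keeps the divisor invertible when `a` is zero. The excess
  -- of `δ + a * δ` over `a * δ` drives the contradiction in `w∞≤c`.
  divide-1+nonneg : ∀ {a ε} → 0# ≤ a → 0# < ε →
                    ∃[ δ ] 0# < δ × δ + a * δ ≈ ε
  divide-1+nonneg {a} {ε} 0≤a (0≤ε , 0≉ε)
    with inverse (1# + a) (1+nonneg≉0 0≤a)
  ... | y , [1+a]y≈1 = δ , (0≤δ , 0≉δ) , δ+aδ≈ε
    where
    δ = y * ε
    δ+aδ≈ε : δ + a * δ ≈ ε
    δ+aδ≈ε = begin
      δ + a * δ          ≈⟨ +-congʳ (*-identityˡ δ) ⟨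
      1# * δ + a * δ     ≈⟨ distribʳ δ 1# a ⟨
      (1# + a) * (y * ε) ≈⟨ *-assoc (1# + a) y ε ⟨
      (1# + a) * y * ε   ≈⟨ *-congʳ [1+a]y≈1 ⟩
      1# * ε             ≈⟨ *-identityˡ ε ⟩
      ε                  ∎
      where open ≈-Reasoning
    -- No sign is known for the inverse `y`, so that of `δ` is read off `δ+aδ≈ε`: a nonpositive `δ`
    -- would make `ε` nonpositive.
    0≤δ : 0# ≤ δ
    0≤δ with ≤-total 0# δ
    ... | inj₁ 0≤δ = 0≤δ
    ... | inj₂ δ≤0 = contradiction (≤-antisym 0≤ε (begin
      ε          ≈⟨ δ+aδ≈ε ⟨
      δ + a * δ  ≤⟨ +-mono-≤ δ≤0 (*-monoˡ-≤ 0≤a δ≤0) ⟩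
      0# + a * 0# ≈⟨ +-identityˡ (a * 0#) ⟩
      a * 0#     ≈⟨ zeroʳ a ⟩
      0#         ∎)) 0≉ε
      where open ≤-Reasoning
    0≉δ : ¬ 0# ≈ δ
    0≉δ 0≈δ = 0≉ε (begin
      0#           ≈⟨ zeroʳ a ⟨
      a * 0#       ≈⟨ +-identityˡ (a * 0#) ⟨
      0# + a * 0#  ≈⟨ +-cong 0≈δ (*-congˡ 0≈δ) ⟩
      δ + a * δ    ≈⟨ δ+aδ≈ε ⟩
      ε            ∎)
      where open ≈-Reasoning

  -- Finite sums and sums with nonnegative weights.

  sum-mono-≤ : ∀ {n} {f g : Vector ℝ n} → (∀ i → f i ≤ g i) → sum f ≤ sum g
  sum-mono-≤ {zero}  f≤g = ≤-refl
  sum-mono-≤ {suc n} f≤g = +-mono-≤ (f≤g zero) (sum-mono-≤ (f≤g ∘ suc))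

  sum-nonneg : ∀ {n} {f : Vector ℝ n} → (∀ i → 0# ≤ f i) → 0# ≤ sum f
  sum-nonneg {zero}  0≤f = ≤-refl
  sum-nonneg {suc n} 0≤f =
    ≤-respˡ-≈ (+-identityˡ 0#) (+-mono-≤ (0≤f zero) (sum-nonneg (0≤f ∘ suc)))

  ≤-sum : ∀ {n} {f : Vector ℝ n} → (∀ i → 0# ≤ f i) → ∀ i → f i ≤ sum f
  ≤-sum {f = f} 0≤f zero =
    ≤-respˡ-≈ (+-identityʳ (f zero)) (+-monoʳ-≤ (f zero) (sum-nonneg (0≤f ∘ suc)))
  ≤-sum {f = f} 0≤f (suc i) =
    ≤-respˡ-≈ (+-identityˡ (f (suc i))) (+-mono-≤ (0≤f zero) (≤-sum (0≤f ∘ suc) i))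

  dot : ∀ {n} → Vector ℝ n → Vector ℝ n → ℝ
  dot a x = sum λ i → a i * x i

  dot-mono-≤ : ∀ {n} {a x y : Vector ℝ n} → (∀ i → 0# ≤ a i) →
               (∀ i → x i ≤ y i) → dot a x ≤ dot a y
  dot-mono-≤ 0≤a x≤y = sum-mono-≤ λ i → *-monoˡ-≤ (0≤a i) (x≤y i)

  -- A uniform error `δ` in the arguments costs at most the total weight times `δ`; this one-sided
  -- estimate controls the functional near the limit.
  dot-shift : ∀ {n} {a x y : Vector ℝ n} {δ} → (∀ i → 0# ≤ a i) →
              (∀ i → x i ≤ δ + y i) → dot a x ≤ sum a * δ + dot a y
  dot-shift {a = a} {x} {y} {δ} 0≤a x≤δ+y = begin
    dot a x                              ≤⟨ dot-mono-≤ 0≤a x≤δ+y ⟩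
    dot a (λ i → δ + y i)                ≈⟨ sum-cong-≋ (λ i → distribˡ (a i) δ (y i)) ⟩
    sum (λ i → a i * δ + a i * y i)      ≈⟨ ∑-distrib-+ (λ i → a i * δ) (λ i → a i * y i) ⟩
    sum (λ i → a i * δ) + dot a y        ≈⟨ +-congʳ (*-distribʳ-sum δ a) ⟨
    sum a * δ + dot a y                  ∎
    where open ≤-Reasoning

-- Coefficients of formal sums.

module PolynomialProperties (R : CompleteOrderedField) (em : ExcludedMiddle 0ℓ) where

  open Analysis R em hiding (zero)
  open OrderedFieldProperties R
  open AbelianGroupProperties +-abelianGroup using (⁻¹-∙-comm; ε⁻¹≈ε)
  open CommutativeSemigroupProperties +-commutativeSemigroup using (interchange)
  open CommutativeSemigroupProperties *-commutativeSemigroup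
    using () renaming (interchange to *-interchange)
  open RingProperties ring using (-‿distribˡ-*)
  open RawSemiringOps rawSemiring using (product; _^_)
  open Exp semiring using (^-homo-*)
  open ≈-Reasoning

  coeff-∷-≢ : ∀ {d} c {α β : Monomial d} p → α ≢ β →
              coeff ((c , α) ∷ p) β ≈ coeff p β
  coeff-∷-≢ c {α} {β} p α≢β with ≡-dec ℕ._≟_ α β
  ... | yes α≡β = contradiction α≡β α≢β
  ... | no _    = refl

  coeff-+ : ∀ {d} (p q : Poly d) α → coeff (p +ₚ q) α ≈ coeff p α + coeff q α
  coeff-+ []            q α = sym (+-identityˡ _)
  coeff-+ ((c , β) ∷ p) q α with ≡-dec ℕ._≟_ β α
  ... | yes _ = trans (+-congˡ (coeff-+ p q α)) (sym (+-assoc c _ _))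
  ... | no _  = coeff-+ p q α

  coeff-neg : ∀ {d} (p : Poly d) α → coeff (-ₚ p) α ≈ - coeff p α
  coeff-neg []            α = sym ε⁻¹≈ε
  coeff-neg ((c , β) ∷ p) α with ≡-dec ℕ._≟_ β α
  ... | yes _ = trans (+-congˡ (coeff-neg p α)) (⁻¹-∙-comm c _)
  ... | no _  = coeff-neg p α

  coeff-- : ∀ {d} (p q : Poly d) α → coeff (p -ₚ q) α ≈ coeff p α - coeff q α
  coeff-- p q α = trans (coeff-+ p (-ₚ q) α) (+-congˡ (coeff-neg q α))

  -- Constants contribute to the zero exponent only; at any other exponent both sides are the same
  -- difference of zeros.
  coeff-const-difference : ∀ {d a b c e} → a - b ≈ c - e → ∀ (α : Monomial d) →
    coeff (const a) α - coeff (const b) α ≈ coeff (const c) α - coeff (const e) α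
  coeff-const-difference {a = a} {b} {c} {e} a-b≈c-e α
    with ≡-dec ℕ._≟_ (replicate _ 0) α
  ... | no _  = refl
  ... | yes _ = begin
    (a + 0#) - (b + 0#)  ≈⟨ +-cong (+-identityʳ a) (-‿cong (+-identityʳ b)) ⟩
    a - b                ≈⟨ a-b≈c-e ⟩
    c - e                ≈⟨ +-cong (+-identityʳ c) (-‿cong (+-identityʳ e)) ⟨
    (c + 0#) - (e + 0#)  ∎

  -- Evaluation as a ring homomorphism.

  monomial : ∀ {d} → Monomial d → Point d → ℝ
  monomial α x = product λ j → x j ^ lookup α j

  monomial-0 : ∀ {d} (x : Point d) → monomial (replicate _ 0) x ≈ 1#
  monomial-0 {zero}  x = refl
  monomial-0 {suc d} x = trans (*-identityˡ _) (monomial-0 (x ∘ suc))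

  monomial-+ : ∀ {d} (α β : Monomial d) (x : Point d) →
    monomial (zipWith ℕ._+_ α β) x ≈ monomial α x * monomial β x
  monomial-+ []      []      x = sym (*-identityˡ 1#)
  monomial-+ (a ∷ α) (b ∷ β) x = begin
    x zero ^ (a ℕ.+ b) * monomial (zipWith ℕ._+_ α β) (x ∘ suc)
      ≈⟨ *-cong (^-homo-* (x zero) a b) (monomial-+ α β (x ∘ suc)) ⟩
    (x zero ^ a * x zero ^ b) * (monomial α (x ∘ suc) * monomial β (x ∘ suc))
      ≈⟨ *-interchange _ _ _ _ ⟩
    (x zero ^ a * monomial α (x ∘ suc)) * (x zero ^ b * monomial β (x ∘ suc)) ∎

  eval-+ : ∀ {d} (p q : Poly d) x → eval (p +ₚ q) x ≈ eval p x + eval q x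
  eval-+ []            q x = sym (+-identityˡ _)
  eval-+ ((c , α) ∷ p) q x = trans (+-congˡ (eval-+ p q x)) (sym (+-assoc _ _ _))

  eval-neg : ∀ {d} (p : Poly d) x → eval (-ₚ p) x ≈ - eval p x
  eval-neg []            x = sym ε⁻¹≈ε
  eval-neg ((c , α) ∷ p) x = begin
    - c * monomial α x + eval (-ₚ p) x    ≈⟨ +-cong (sym (-‿distribˡ-* c _)) (eval-neg p x) ⟩
    - (c * monomial α x) + - eval p x     ≈⟨ ⁻¹-∙-comm _ _ ⟩
    - (c * monomial α x + eval p x)       ∎

  eval-- : ∀ {d} (p q : Poly d) x → eval (p -ₚ q) x ≈ eval p x - eval q x
  eval-- p q x = trans (eval-+ p (-ₚ q) x) (+-congˡ (eval-neg q x))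

  eval-const : ∀ {d} c (x : Point d) → eval (const c) x ≈ c
  eval-const c x = begin
    c * monomial (replicate _ 0) x + 0#  ≈⟨ +-identityʳ _ ⟩
    c * monomial (replicate _ 0) x       ≈⟨ *-congˡ (monomial-0 x) ⟩
    c * 1#                               ≈⟨ *-identityʳ c ⟩
    c                                    ∎

  eval-term-* : ∀ {d} a (α : Monomial d) (q : Poly d) x →
    eval (List.map (λ (b , β) → a * b , zipWith ℕ._+_ α β) q) x
      ≈ (a * monomial α x) * eval q x
  eval-term-* a α []            x = sym (zeroʳ _)
  eval-term-* a α ((b , β) ∷ q) x = begin
    (a * b) * monomial (zipWith ℕ._+_ α β) x
      + eval (List.map (λ (b , β) → a * b , zipWith ℕ._+_ α β) q) x
      ≈⟨ +-cong (*-congˡ (monomial-+ α β x)) (eval-term-* a α q x) ⟩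
    (a * b) * (monomial α x * monomial β x) + (a * monomial α x) * eval q x
      ≈⟨ +-congʳ (*-interchange a b _ _) ⟩
    (a * monomial α x) * (b * monomial β x) + (a * monomial α x) * eval q x
      ≈⟨ distribˡ _ _ _ ⟨
    (a * monomial α x) * (b * monomial β x + eval q x) ∎

  eval-* : ∀ {d} (p q : Poly d) x → eval (p *ₚ q) x ≈ eval p x * eval q x
  eval-* []            q x = sym (zeroˡ _)
  eval-* ((a , α) ∷ p) q x = begin
    eval (List.map (λ (b , β) → a * b , zipWith ℕ._+_ α β) q +ₚ p *ₚ q) x
      ≈⟨ eval-+ (List.map (λ (b , β) → a * b , zipWith ℕ._+_ α β) q) (p *ₚ q) x ⟩
    eval (List.map (λ (b , β) → a * b , zipWith ℕ._+_ α β) q) x + eval (p *ₚ q) x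
      ≈⟨ +-cong (eval-term-* a α q x) (eval-* p q x) ⟩
    (a * monomial α x) * eval q x + eval p x * eval q x
      ≈⟨ distribʳ _ _ _ ⟨
    (a * monomial α x + eval p x) * eval q x ∎

  -- Independence of evaluation from the representing formal sum.

  remove : ∀ {d} → Monomial d → Poly d → Poly d
  remove α = List.filter λ (_ , β) → ¬? (≡-dec ℕ._≟_ β α)

  coeff-remove-≡ : ∀ {d} (α : Monomial d) p → coeff (remove α p) α ≈ 0#
  coeff-remove-≡ α []            = refl
  coeff-remove-≡ α ((c , β) ∷ p) with ≡-dec ℕ._≟_ β α
  ... | yes _  = coeff-remove-≡ α p
  ... | no β≢α = trans (coeff-∷-≢ c (remove α p) β≢α) (coeff-remove-≡ α p)

  coeff-remove-≢ : ∀ {d} {α β : Monomial d} p → α ≢ β →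
                   coeff (remove α p) β ≈ coeff p β
  coeff-remove-≢ []            α≢β = refl
  coeff-remove-≢ {α = α} {β} ((c , γ) ∷ p) α≢β with ≡-dec ℕ._≟_ γ α
  ... | yes ≡.refl = trans (coeff-remove-≢ p α≢β) (sym (coeff-∷-≢ c p α≢β))
  ... | no _ with ≡-dec ℕ._≟_ γ β
  ...   | yes _ = +-congˡ (coeff-remove-≢ p α≢β)
  ...   | no _  = coeff-remove-≢ p α≢β

  eval-remove : ∀ {d} (α : Monomial d) p x →
                eval p x ≈ coeff p α * monomial α x + eval (remove α p) x
  eval-remove α []            x = sym (trans (+-identityʳ _) (zeroˡ _))
  eval-remove α ((c , β) ∷ p) x with ≡-dec ℕ._≟_ β α
  ... | yes ≡.refl = begin
    c * monomial α x + eval p x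
      ≈⟨ +-congˡ (eval-remove α p x) ⟩
    c * monomial α x + (coeff p α * monomial α x + eval (remove α p) x)
      ≈⟨ +-assoc _ _ _ ⟨
    (c * monomial α x + coeff p α * monomial α x) + eval (remove α p) x
      ≈⟨ +-congʳ (distribʳ _ c _) ⟨
    (c + coeff p α) * monomial α x + eval (remove α p) x ∎
  ... | no _ = begin
    c * monomial β x + eval p x
      ≈⟨ +-congˡ (eval-remove α p x) ⟩
    c * monomial β x + (coeff p α * monomial α x + eval (remove α p) x)
      ≈⟨ x∙yz≈y∙xz _ _ _ ⟩
    coeff p α * monomial α x + (c * monomial β x + eval (remove α p) x) ∎
    where open CommutativeSemigroupProperties +-commutativeSemigroup using (x∙yz≈y∙xz)

  -- Removing the first monomial shortens the formal sum and keeps all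
  -- coefficients zero; the bound n makes the recursion structural.
  eval-null : ∀ {d} n (p : Poly d) → List.length p ℕ.≤ n →
              (∀ α → coeff p α ≈ 0#) → ∀ x → eval p x ≈ 0#
  eval-null n       []            _         p≈0 x = refl
  eval-null (suc n) ((c , α) ∷ p) (s≤s p≤n) p≈0 x = begin
    c * monomial α x + eval p x
      ≈⟨ eval-remove α ((c , α) ∷ p) x ⟩
    coeff ((c , α) ∷ p) α * monomial α x + eval (remove α ((c , α) ∷ p)) x
      ≈⟨ +-cong (trans (*-congʳ (p≈0 α)) (zeroˡ _)) rest≈0 ⟩
    0# + 0#
      ≈⟨ +-identityˡ 0# ⟩
    0# ∎
    where
    null : ∀ β → coeff (remove α ((c , α) ∷ p)) β ≈ 0#
    null β with ≡-dec ℕ._≟_ α β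
    ... | yes ≡.refl = coeff-remove-≡ α ((c , α) ∷ p)
    ... | no α≢β     = trans (coeff-remove-≢ ((c , α) ∷ p) α≢β) (p≈0 β)
    rest≈0 : eval (remove α ((c , α) ∷ p)) x ≈ 0#
    -- Abstracting the comparison of `α` with itself in the goal and in the type of `null` together
    -- lets `remove` drop the head term in both.
    rest≈0 with ≡-dec ℕ._≟_ α α | null
    ... | yes _  | null = eval-null n (remove α p)
      (ℕ.≤-trans (List.length-filter (λ (_ , β) → ¬? (≡-dec ℕ._≟_ β α)) p) p≤n) null x
    ... | no α≢α | _    = contradiction ≡.refl α≢α

  -- `≈ₚ` compares coefficients whereas `eval` follows the list of terms; all coefficients of
  -- `p -ₚ q` vanish, so `eval-null` bridges the two.
  eval-cong : ∀ {d} (p q : Poly d) → p ≈ₚ q → ∀ x → eval p x ≈ eval q x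
  eval-cong p q p≈q x = x∙y⁻¹≈ε⇒x≈y _ _ (begin
    eval p x - eval q x  ≈⟨ eval-- p q x ⟨
    eval (p -ₚ q) x      ≈⟨ eval-null _ (p -ₚ q) ℕ.≤-refl null x ⟩
    0#                   ∎)
    where
    open AbelianGroupProperties +-abelianGroup using (x∙y⁻¹≈ε⇒x≈y; x≈y⇒x∙y⁻¹≈ε)
    null : ∀ α → coeff (p -ₚ q) α ≈ 0#
    null α = trans (coeff-- p q α) (x≈y⇒x∙y⁻¹≈ε (p≈q α))

  -- Signs of sums of squares and of multiplier combinations.

  sumOfSquares : ∀ {d} → List (Poly d) → Poly d
  sumOfSquares = List.foldr (λ q s → q *ₚ q +ₚ s) []

  eval-sumOfSquares-nonneg : ∀ {d} (qs : List (Poly d)) x →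
                             0# ≤ eval (sumOfSquares qs) x
  eval-sumOfSquares-nonneg []       x = ≤-refl
  eval-sumOfSquares-nonneg (q ∷ qs) x = ≤-respʳ-≈
    (sym (trans (eval-+ (q *ₚ q) (sumOfSquares qs) x) (+-congʳ (eval-* q q x))))
    (≤-respˡ-≈ (+-identityˡ 0#)
      (+-mono-≤ (square-nonneg (eval q x)) (eval-sumOfSquares-nonneg qs x)))

  eval-SOS-nonneg : ∀ {d} (σ : Poly d) → IsSOS σ → ∀ x → 0# ≤ eval σ x
  eval-SOS-nonneg σ (qs , σ≈qs²) x = ≤-respʳ-≈
    (sym (eval-cong σ (sumOfSquares qs) σ≈qs² x)) (eval-sumOfSquares-nonneg qs x)

  eval-sumₚ-nonpos : ∀ {d n} (f : Vector (Poly d) n) x →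
                     (∀ l → eval (f l) x ≤ 0#) → eval (sumₚ f) x ≤ 0#
  eval-sumₚ-nonpos {n = zero}  f x f≤0 = ≤-refl
  eval-sumₚ-nonpos {n = suc n} f x f≤0 =
    ≤-respˡ-≈ (sym (eval-+ (f zero) _ x)) (≤-respʳ-≈ (+-identityˡ 0#)
      (+-mono-≤ (f≤0 zero) (eval-sumₚ-nonpos (f ∘ suc) x (f≤0 ∘ suc))))

  -- SOS multipliers are nonnegative at every point, so their products with nonpositive constraint
  -- values stay nonpositive.
  eval-⟨⟩-nonpos : ∀ {d n} (μ r : Vector (Poly d) n) x → (∀ l → IsSOS (μ l)) →
                   (∀ l → eval (r l) x ≤ 0#) → eval ⟨ μ , r ⟩ x ≤ 0#
  eval-⟨⟩-nonpos μ r x μ-sos r≤0 = eval-sumₚ-nonpos _ x λ l →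
    ≤-respˡ-≈ (sym (eval-* (μ l) (r l) x)) (≤-respʳ-≈ (zeroʳ _)
      (*-monoˡ-≤ (eval-SOS-nonneg (μ l) (μ-sos l) x) (r≤0 l)))

-- Order, suprema and arithmetic of the extended reals.

module ExtendedRealProperties (R : CompleteOrderedField) (em : ExcludedMiddle 0ℓ) where

  open Analysis R em hiding (zero)
  open OrderedFieldProperties R
  open Sum semiring using (sum)

  module ≤±′ = ExtremaOrder _≤_
  module ≈±′ = ExtremaEquality _≈_
  module ⊔ = Max ≤±-totalOrder

  open TotalOrder ≤±-totalOrder public
    using ()
    renaming (refl to ≤±-refl; trans to ≤±-trans; antisym to ≤±-antisym;
              reflexive to ≤±-reflexive; module Eq to ≈±;
              ≤-respˡ-≈ to ≤±-respˡ-≈; ≤-respʳ-≈ to ≤±-respʳ-≈; poset to ≤±-poset)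

  module ≤±-Reasoning = PartialOrderReasoning ≤±-poset

  x≤sup± : ∀ {n} (f : Vector ℝ± n) i → f i ≤± sup± f
  x≤sup± f zero    = ⊔.x≤x⊔y (f zero) _
  x≤sup± f (suc i) = ≤±-trans (x≤sup± (f ∘ suc) i) (⊔.x≤y⊔x (f zero) _)

  sup±-least : ∀ {n} (f : Vector ℝ± n) {z} → (∀ i → f i ≤± z) → sup± f ≤± z
  sup±-least {zero}  f f≤z = ⊥±≤ _
  sup±-least {suc n} f f≤z = ⊔.⊔-lub (f≤z zero) (sup±-least (f ∘ suc) (f≤z ∘ suc))

  sup±-mono : ∀ {n} {f g : Vector ℝ± n} → (∀ i → f i ≤± g i) → sup± f ≤± sup± g
  sup±-mono {f = f} {g} f≤g = sup±-least f λ i → ≤±-trans (f≤g i) (x≤sup± g i)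

  bounded⇒real : ∀ {a b z} → [ a ] ≤± z → z ≤± [ b ] → ∃[ x ] z ≡ [ x ]
  bounded⇒real {z = [ x ]} _ _ = x , ≡.refl
  bounded⇒real {z = ⊥±} SupremumOrder.[ () ] _
  bounded⇒real {z = ⊤±} _ ()

  -- `inf` takes predicates on reals only, so an infimum is compared with an extended real through
  -- the reals above the latter.
  ≤±-by-reals : ∀ {u v} → (∀ x → v ≤± [ x ] → u ≤± [ x ]) → u ≤± v
  ≤±-by-reals {v = ⊤±}    h = _ ≤⊤±
  ≤±-by-reals {v = [ x ]} h = h x ≤±-refl
  ≤±-by-reals {⊥±}    {⊥±} h = ≤±-refl
  ≤±-by-reals {⊤±}    {⊥±} h with () ← h 0# (⊥±≤ _)
  -- Every real is above `⊥±`; testing `h` at `r - 1#` would put `r` below `r - 1#`.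
  ≤±-by-reals {[ r ]} {⊥±} h = contradiction
    (≤±′.[≤]-injective (h (r - 1#) (⊥±≤ _))) (<⇒≱ r-1<r)
    where
    open AbelianGroupProperties +-abelianGroup using (//-rightDividesˡ; identityʳ-unique)
    r-1<r : r - 1# < r
    r-1<r = x≤y+z⇒x-z≤y (≤-respˡ-≈ (+-identityʳ r) (+-monoʳ-≤ r 0≤1))
          , λ r-1≈r → 0≉1 (sym (identityʳ-unique r 1#
              (trans (+-congʳ (sym r-1≈r)) (//-rightDividesˡ 1# r))))

  +±-cong-real : ∀ {a b x y} → a ≈± [ x ] → b ≈± [ y ] → a +± b ≈± [ x + y ]
  +±-cong-real ≈±′.[ a≈x ] ≈±′.[ b≈y ] = ≈±′.[ +-cong a≈x b≈y ]

  ·±-cong-real : ∀ a {b y} → b ≈± [ y ] → a ·± b ≈± [ a * y ]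
  ·±-cong-real a ≈±′.[ b≈y ] = ≈±′.[ *-congˡ b≈y ]

  -±-cong-real : ∀ {b y} → b ≈± [ y ] → -± b ≈± [ - y ]
  -±-cong-real ≈±′.[ b≈y ] = ≈±′.[ -‿cong b≈y ]

  sum±-cong-real : ∀ {n} {f : Vector ℝ± n} {g : Vector ℝ n} →
                   (∀ i → f i ≈± [ g i ]) → sum± f ≈± [ sum g ]
  sum±-cong-real {zero}  f≈g = ≈±.refl
  sum±-cong-real {suc n} f≈g = +±-cong-real (f≈g zero) (sum±-cong-real (f≈g ∘ suc))

  +±-comm : ∀ a b → a +± b ≈± b +± a
  +±-comm ⊥±    ⊥±    = ≈±.refl
  +±-comm ⊥±    [ y ] = ≈±.refl
  +±-comm ⊥±    ⊤±    = ≈±.refl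
  +±-comm [ x ] ⊥±    = ≈±.refl
  +±-comm [ x ] [ y ] = ≈±′.[ +-comm x y ]
  +±-comm [ x ] ⊤±    = ≈±.refl
  +±-comm ⊤±    ⊥±    = ≈±.refl
  +±-comm ⊤±    [ y ] = ≈±.refl
  +±-comm ⊤±    ⊤±    = ≈±.refl

  +±-monoˡ : ∀ {a b} c → a ≤± b → a +± c ≤± b +± c
  +±-monoˡ {b = ⊤±} c     _ = _ ≤⊤±
  +±-monoˡ {⊥±} {⊥±}    c a≤b = ≤±-refl
  +±-monoˡ {⊥±} {[ y ]} ⊤± a≤b = ≤±-refl
  +±-monoˡ {⊥±} {[ y ]} ⊥± a≤b = ≤±-refl
  +±-monoˡ {⊥±} {[ y ]} [ z ] a≤b = ⊥±≤ _
  +±-monoˡ {[ x ]} {⊥±} c SupremumOrder.[ () ]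
  +±-monoˡ {[ x ]} {[ y ]} ⊥± a≤b = ≤±-refl
  +±-monoˡ {[ x ]} {[ y ]} ⊤± a≤b = ≤±-refl
  +±-monoˡ {[ x ]} {[ y ]} [ z ] ≤±′.[ x≤y ] = ≤±′.[ +-monoˡ-≤ z x≤y ]
  +±-monoˡ {⊤±} {⊥±}    c ()
  +±-monoˡ {⊤±} {[ y ]} c ()

  +±-mono : ∀ {a b c e} → a ≤± b → c ≤± e → a +± c ≤± b +± e
  +±-mono {a} {b} {c} {e} a≤b c≤e = begin
    a +± c  ≤⟨ +±-monoˡ c a≤b ⟩
    b +± c  ≈⟨ +±-comm b c ⟩
    c +± b  ≤⟨ +±-monoˡ b c≤e ⟩
    e +± b  ≈⟨ +±-comm e b ⟩
    b +± e  ∎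
    where open ≤±-Reasoning

  -- Because `0 · (±∞) = 0`, comparing an infinite argument with a different one needs a split on
  -- `a ≈ 0#`: then both sides are zero, otherwise the left is `⊥±` or the right is `⊤±`.
  ·±-mono : ∀ {a u v} → 0# ≤ a → u ≤± v → a ·± u ≤± a ·± v
  ·±-mono {a} {[ x ]} {[ y ]} 0≤a ≤±′.[ x≤y ] = ≤±′.[ *-monoˡ-≤ 0≤a x≤y ]
  ·±-mono {a} {⊥±}    {⊥±}    0≤a u≤v = ≤±-refl
  ·±-mono {a} {⊤±}    {⊤±}    0≤a u≤v = ≤±-refl
  ·±-mono {a} {[ x ]} {⊥±}    0≤a SupremumOrder.[ () ]
  ·±-mono {a} {⊤±}    {⊥±}    0≤a ()
  ·±-mono {a} {⊤±}    {[ y ]} 0≤a ()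
  ·±-mono {a} {⊥±}    {[ y ]} 0≤a u≤v with em {P = a ≈ 0#}
  ... | yes a≈0 = ≤±-reflexive ≈±′.[ sym (trans (*-congʳ a≈0) (zeroˡ y)) ]
  ... | no _    = ⊥±≤ _
  ·±-mono {a} {[ x ]} {⊤±}    0≤a u≤v with em {P = a ≈ 0#}
  ... | yes a≈0 = ≤±-reflexive ≈±′.[ trans (*-congʳ a≈0) (zeroˡ x) ]
  ... | no _    = _ ≤⊤±
  ·±-mono {a} {⊥±}    {⊤±}    0≤a u≤v with em {P = a ≈ 0#}
  ... | yes _ = ≤±-refl
  ... | no _  = _ ≤⊤±

  sum±-mono : ∀ {n} {f g : Vector ℝ± n} → (∀ i → f i ≤± g i) → sum± f ≤± sum± g
  sum±-mono {zero}  f≤g = ≤±-refl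
  sum±-mono {suc n} f≤g = +±-mono (f≤g zero) (sum±-mono (f≤g ∘ suc))

  inf-lower : ∀ (S : Pred ℝ 0ℓ) {x} → S x → inf S ≤± [ x ]
  inf-lower S = proj₁ (proj₂ (infimum S)) _

  inf-greatest : ∀ (S : Pred ℝ 0ℓ) {z} → (∀ x → S x → z ≤± [ x ]) → z ≤± inf S
  inf-greatest S = proj₂ (proj₂ (infimum S)) _

  -- Least fixpoints by Knaster-Tarski.

  module KnasterTarski {n} (f : Vector ℝ± n → Vector ℝ± n)
    (f-mono : ∀ {v w} → (∀ p → v p ≤± w p) → ∀ p → f v p ≤± f w p) where

    PostFixpoint : Pred (Vector ℝ± n) 0ℓ
    PostFixpoint v = ∀ p → f v p ≤± v p

    -- Collects the real upper bounds of post-fixpoint values at `p`; its `inf` is the infimum of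
    -- those values, even when some of them are infinite.
    ValueBound : Fin n → Pred ℝ 0ℓ
    ValueBound p x = Σ[ v ∈ Vector ℝ± n ] PostFixpoint v × v p ≤± [ x ]

    μf : Vector ℝ± n
    μf p = inf (ValueBound p)

    μf-lower : ∀ {v} → PostFixpoint v → ∀ p → μf p ≤± v p
    μf-lower {v} fv≤v p =
      ≤±-by-reals λ x vp≤x → inf-lower (ValueBound p) (v , fv≤v , vp≤x)

    μf-post : PostFixpoint μf
    μf-post p = inf-greatest (ValueBound p) λ x (v , fv≤v , vp≤x) →
      ≤±-trans (f-mono (μf-lower fv≤v) p) (≤±-trans (fv≤v p) vp≤x)

    -- By monotonicity `f μf` is itself a post-fixpoint, so `μf` lies below it as well.
    μf-fixpoint : ∀ p → f μf p ≈± μf p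
    μf-fixpoint p = ≤±-antisym (μf-post p) (μf-lower (f-mono μf-post) p)

-- Limits of decreasing real sequences.

module DecreasingSequences (R : CompleteOrderedField) (em : ExcludedMiddle 0ℓ) where

  open Analysis R em hiding (zero)
  open OrderedFieldProperties R

  Limit : (ℕ → ℝ) → ℝ → Set
  Limit u l = ∀ ε → 0# < ε → ∃[ N ] ∀ k → N ℕ.≤ k → u k - l < ε × l - u k < ε

  Decreasing : (ℕ → ℝ) → Set
  Decreasing u = ∀ k → u (suc k) ≤ u k

  antitone : ∀ {u} → Decreasing u → ∀ {k l} → k ℕ.≤ l → u l ≤ u k
  antitone {u} dec k≤l = go (ℕ.≤⇒≤′ k≤l)
    where
    go : ∀ {k l} → k ℕ.≤′ l → u l ≤ u k
    go ℕ.≤′-refl       = ≤-refl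
    go (ℕ.≤′-step k≤l) = ≤-trans (dec _) (go k≤l)

  limit-greatest : ∀ {u l z} → Limit u l → (∀ k → z ≤ u k) → z ≤ l
  limit-greatest {u} {l} {z} u→l z≤u with em {P = z ≤ l}
  ... | yes z≤l = z≤l
  ... | no z≰l with u→l (z - l) (x<y⇒0<y-x (≰⇒> z≰l))
  ...   | N , close = contradiction (+-monoˡ-≤ (- l) (z≤u N))
                        (<⇒≱ (proj₁ (close N ℕ.≤-refl)))

  limit-lower : ∀ {u l} → Decreasing u → Limit u l → ∀ k → l ≤ u k
  limit-lower {u} {l} dec u→l k with em {P = l ≤ u k}
  ... | yes l≤uk = l≤uk
  -- At index `N ⊔ k` the sequence would be both within `l - u k` of `l` and at most `u k`.
  ... | no l≰uk with u→l (l - u k) (x<y⇒0<y-x (≰⇒> l≰uk))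
  ...   | N , close = contradiction
    (+-monoʳ-≤ l (neg-antimono-≤ (antitone dec (ℕ.m≤n⊔m N k))))
    (<⇒≱ (proj₂ (close (N ℕ.⊔ k) (ℕ.m≤m⊔n N k))))

  monotone-convergence : ∀ {u b} → Decreasing u → (∀ k → b ≤ u k) → ∃ (Limit u)
  monotone-convergence {u} {b} dec b≤u
    -- Completeness supplies suprema, so the infimum `l` is taken as the supremum of the lower
    -- bounds of `u`.
    with complete (λ b → ∀ k → b ≤ u k) (b , b≤u) (u 0 , λ _ b≤u → b≤u 0)
  ... | l , upper , least = l , limit
    where
    limit : Limit u l
    -- If no term drops below `ε + l`, that number is a lower bound exceeding `l`; once one does,
    -- monotonicity keeps all later terms there.
    limit ε 0<ε with em {P = ∃[ N ] ¬ ε + l ≤ u N}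
    ... | no none = contradiction (upper (ε + l) ε+l≤u) (λ ε+l≤l →
        <⇒≱ 0<ε (≤-respʳ-≈ (-‿inverseʳ l) (x+z≤y⇒x≤y-z ε+l≤l)))
      where
      ε+l≤u : ∀ N → ε + l ≤ u N
      ε+l≤u N with em {P = ε + l ≤ u N}
      ... | yes p = p
      ... | no ¬p = contradiction (N , ¬p) none
    ... | yes (N , ε+l≰uN) = N , λ k N≤k →
        ≰⇒> (λ ε≤uk-l → ε+l≰uN (≤-trans (x≤y-z⇒x+z≤y ε≤uk-l) (antitone dec N≤k)))
      , ≰⇒> (λ ε≤l-uk → <⇒≱ 0<ε (≤-trans ε≤l-uk
          (≤-respʳ-≈ (-‿inverseʳ (u k))
            (+-monoˡ-≤ (- u k) (least (u k) λ _ b≤u → b≤u k)))))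

  -- Over a finite index set the maximum of the separate thresholds is a common one; applied to the
  -- templates.
  eventually-∀ : ∀ {n} {Q : Fin n → Pred ℕ 0ℓ} →
                 (∀ q → ∃[ N ] ∀ k → N ℕ.≤ k → Q q k) →
                 ∃[ N ] ∀ k → N ℕ.≤ k → ∀ q → Q q k
  eventually-∀ {zero}  ev = 0 , λ _ _ ()
  eventually-∀ {suc n} ev with ev zero | eventually-∀ (ev ∘ suc)
  ... | N₀ , h₀ | N , h = N₀ ℕ.⊔ N , λ where
    k N≤k zero    → h₀ k (ℕ.m⊔n≤o⇒m≤o N₀ N N≤k)
    k N≤k (suc q) → h k (ℕ.m⊔n≤o⇒n≤o N₀ N N≤k) q

-- Certificates for the relaxed functional.

module PolicyIterationProperties
  (R : CompleteOrderedField) (em : ExcludedMiddle 0ℓ) {d m : ℕ}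
  (sys : Analysis.System R em d) (tpl : Analysis.Templates R em d m) where

  open Analysis R em hiding (zero)
  open OrderedFieldProperties R
  open PolynomialProperties R em
  open ExtendedRealProperties R em
  open DecreasingSequences R em
  open PolicyIteration sys tpl
  open BasicSemialgebraic using (poly; compare; Member)
  open AbelianGroupProperties +-abelianGroup using (⁻¹-anti-homo‿-; xyx⁻¹≈y)
  open CommutativeMonoidSolver +-commutativeMonoid using (solve; _⊜_; _⊕_)
  open Sum semiring using (sum)

  combine-real : ∀ λ′ {w u} → w ≈𝓕 embed u → combine λ′ w ≈± [ dot λ′ u ]
  combine-real λ′ w≈u = sum±-cong-real λ q → ·±-cong-real (λ′ q) (w≈u q)

  module _ (i : I) (p : P) (M : Multipliers i) where

    open Multipliers M

    private
      pT C ⟨μ,r⟩ ⟨γ,r⁰⟩ : Poly d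
      pT     = template p ∘ₚ T i
      C      = combineₚ λ′
      ⟨μ,r⟩  = ⟨ μ , poly (X i) ⟩
      ⟨γ,r⁰⟩ = ⟨ γ , poly X⁰ ⟩

    coeff-Constraint : ∀ η s α →
      coeff (const η -ₚ pT -ₚ (const s -ₚ C) +ₚ (⟨μ,r⟩ +ₚ ⟨γ,r⁰⟩)) α
        ≈ (coeff (const η) α - coeff pT α - (coeff (const s) α - coeff C α))
            + (coeff ⟨μ,r⟩ α + coeff ⟨γ,r⁰⟩ α)
    coeff-Constraint η s α =
      trans (coeff-+ (const η -ₚ pT -ₚ (const s -ₚ C)) (⟨μ,r⟩ +ₚ ⟨γ,r⁰⟩) α)
      (+-cong
        (trans (coeff-- (const η -ₚ pT) (const s -ₚ C) α)
          (+-cong (coeff-- (const η) pT α) (-‿cong (coeff-- (const s) C α))))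
        (coeff-+ ⟨μ,r⟩ ⟨γ,r⁰⟩ α))

    coeff-Identity : ∀ s α →
      coeff (pT +ₚ (const s -ₚ C) -ₚ ⟨μ,r⟩ -ₚ ⟨γ,r⁰⟩ +ₚ σ) α
        ≈ (coeff pT α + (coeff (const s) α - coeff C α)
            - coeff ⟨μ,r⟩ α - coeff ⟨γ,r⁰⟩ α) + coeff σ α
    coeff-Identity s α =
      trans (coeff-+ (pT +ₚ (const s -ₚ C) -ₚ ⟨μ,r⟩ -ₚ ⟨γ,r⁰⟩) σ α) (+-congʳ
      (trans (coeff-- (pT +ₚ (const s -ₚ C) -ₚ ⟨μ,r⟩) ⟨γ,r⁰⟩ α) (+-congʳ
      (trans (coeff-- (pT +ₚ (const s -ₚ C)) ⟨μ,r⟩ α) (+-congʳ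
      (trans (coeff-+ pT (const s -ₚ C) α) (+-congˡ (coeff-- (const s) C α))))))))

    -- `η` and `s` enter only as constants with opposite signs, so the constraint depends on `η - s`
    -- alone and `σ`, `μ`, `γ` may be kept.
    Constraint-shift : ∀ {η s η′ s′} → η - s ≈ η′ - s′ →
      Constraint i p M η [ s ] → Constraint i p M η′ [ s′ ]
    Constraint-shift {η} {s} {η′} {s′} η-s≈η′-s′ eq α = begin
      coeff (const η′ -ₚ pT -ₚ (const s′ -ₚ C) +ₚ (⟨μ,r⟩ +ₚ ⟨γ,r⁰⟩)) α
        ≈⟨ coeff-Constraint η′ s′ α ⟩
      (k (const η′) - k pT - (k (const s′) - k C)) + G
        ≈⟨ regroup (k (const η′)) (k pT) (k (const s′)) (k C) G ⟩
      (k (const η′) - k (const s′)) + (k C - k pT + G)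
        ≈⟨ +-congʳ (coeff-const-difference η-s≈η′-s′ α) ⟨
      (k (const η) - k (const s)) + (k C - k pT + G)
        ≈⟨ regroup (k (const η)) (k pT) (k (const s)) (k C) G ⟨
      (k (const η) - k pT - (k (const s) - k C)) + G
        ≈⟨ coeff-Constraint η s α ⟨
      coeff (const η -ₚ pT -ₚ (const s -ₚ C) +ₚ (⟨μ,r⟩ +ₚ ⟨γ,r⁰⟩)) α
        ≈⟨ eq α ⟩
      coeff σ α ∎
      where
      open ≈-Reasoning
      k : Poly d → ℝ
      k q = coeff q α
      G = k ⟨μ,r⟩ + k ⟨γ,r⁰⟩
      regroup : ∀ h x y z g → (h - x - (y - z)) + g ≈ (h - y) + (z - x + g)
      regroup h x y z g = trans (+-congʳ (+-congˡ (⁻¹-anti-homo‿- y z)))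
        (solve 5 (λ h x y z g → ((h ⊕ x) ⊕ (z ⊕ y)) ⊕ g ⊜ (h ⊕ y) ⊕ ((z ⊕ x) ⊕ g))
          refl h (- x) (- y) z g)

    Constraint-cong : ∀ {η z z′} → z ≈± z′ →
                      Constraint i p M η z → Constraint i p M η z′
    Constraint-cong ≈±′.⊤±≈⊤±   = λ c → c
    Constraint-cong ≈±′.⊥±≈⊥±   = λ c → c
    Constraint-cong ≈±′.[ s≈s′ ] = Constraint-shift (+-congˡ (-‿cong s≈s′))

    -- Solving the identity for `σ` gives the constraint at `η = c`, so a solution is a feasible
    -- certificate for the value it names.
    Identity⇒Constraint : ∀ {c s} → Identity i p M [ c ] [ s ] →
                          Constraint i p M c [ s ]
    Identity⇒Constraint {c} {s} eq α = begin
      coeff (const c -ₚ pT -ₚ (const s -ₚ C) +ₚ (⟨μ,r⟩ +ₚ ⟨γ,r⁰⟩)) α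
        ≈⟨ coeff-Constraint c s α ⟩
      (k (const c) - k pT - D) + (k ⟨μ,r⟩ + k ⟨γ,r⁰⟩)
        ≈⟨ +-congʳ (+-congʳ (+-congʳ (trans (eq α) (coeff-Identity s α)))) ⟩
      ((k pT + D - k ⟨μ,r⟩ - k ⟨γ,r⁰⟩ + k σ) - k pT - D) + (k ⟨μ,r⟩ + k ⟨γ,r⁰⟩)
        ≈⟨ cancel (k pT) D (k ⟨μ,r⟩) (k ⟨γ,r⁰⟩) (k σ) ⟩
      coeff σ α ∎
      where
      open ≈-Reasoning
      k : Poly d → ℝ
      k q = coeff q α
      D = k (const s) - k C
      cancel : ∀ x y z g e → ((x + y - z - g + e) - x - y) + (z + g) ≈ e
      cancel x y z g e = begin
        ((x + y - z - g + e) - x - y) + (z + g)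
          ≈⟨ solve 9 (λ x y z g e x⁻ y⁻ z⁻ g⁻ →
               ((((((x ⊕ y) ⊕ z⁻) ⊕ g⁻) ⊕ e) ⊕ x⁻) ⊕ y⁻) ⊕ (z ⊕ g)
                 ⊜ ((((e ⊕ (x ⊕ x⁻)) ⊕ (y ⊕ y⁻)) ⊕ (z ⊕ z⁻)) ⊕ (g ⊕ g⁻)))
               refl x y z g e (- x) (- y) (- z) (- g) ⟩
        e + (x - x) + (y - y) + (z - z) + (g - g)
          ≈⟨ drop g (drop z (drop y (drop x refl))) ⟩
        e ∎
        where
        drop : ∀ x {y e} → y ≈ e → y + (x - x) ≈ e
        drop x y≈e = trans (+-cong y≈e (-‿inverseʳ x)) (+-identityʳ _)

    -- Moving `η` by the change in the weighted sum leaves `η - s` fixed, so the same multipliers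
    -- stay feasible at `v`. Monotonicity of `F_i`, its domination by `φ` and the estimate near the
    -- limit all rest on this affine bound.
    F_i-transfer : ∀ {η s v u} → Constraint i p M η [ s ] → v ≈𝓕 embed u →
                   F_i i v p ≤± [ η + (dot λ′ u - s) ]
    F_i-transfer {η} {s} {v} {u} con v≈u = inf-lower
      (λ η → Σ[ M ∈ Multipliers i ] Constraint i p M η (combine (Multipliers.λ′ M) v))
      (M , Constraint-cong (≈±.sym (combine-real λ′ v≈u)) (Constraint-shift shift con))
      where
      shift : η - s ≈ η + (dot λ′ u - s) - dot λ′ u
      shift = sym (begin
        η + (dot λ′ u - s) - dot λ′ u    ≈⟨ +-assoc η _ _ ⟩
        η + (dot λ′ u - s - dot λ′ u)    ≈⟨ +-congˡ (xyx⁻¹≈y _ _) ⟩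
        η - s                            ∎)
        where open ≈-Reasoning

    Identity-real : ∀ {y z} → Identity i p M y z → ∃[ c ] ∃[ s ]
                    y ≡ [ c ] × z ≡ [ s ] × Constraint i p M c [ s ]
    Identity-real {[ c ]} {[ s ]} eq =
      c , s , ≡.refl , ≡.refl , Identity⇒Constraint eq

  -- `Identity` is empty at infinite values, so a solution makes `F_i` finite and shows that its
  -- infimum is attained.
  Sol-real : ∀ {w u i p} → w ≈𝓕 embed u → ((M , _) : Sol w i p) →
             ∃[ c ] F_i i w p ≡ [ c ] ×
                    Constraint i p M c [ dot (Multipliers.λ′ M) u ]
  Sol-real {i = i} {p} w≈u (M , eq) with Identity-real i p M eq
  ... | c , s , F≡c , comb≡s , con = c , F≡c , Constraint-cong i p M
    (≈±.trans (≈±.reflexive (≡.sym comb≡s)) (combine-real (Multipliers.λ′ M) w≈u)) con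

  -- Monotonicity and lower bounds of the relaxed functional.

  F_i-mono : ∀ i {v w} → IsReal v → IsReal w → v ≤𝓕 w → F_i i v ≤𝓕 F_i i w
  F_i-mono i {v} {w} (u , v≈u) (u′ , w≈u′) v≤w p = inf-greatest
    (λ η → Σ[ M ∈ Multipliers i ] Constraint i p M η (combine (Multipliers.λ′ M) w))
    -- A certificate at `w` transfers to `v`; its value can only drop, because `λ′` is nonnegative
    -- and `v` lies below `w`.
    λ η (M , con) → let open Multipliers M in ≤±-trans
      (F_i-transfer i p M (Constraint-cong i p M (combine-real λ′ w≈u′) con) v≈u)
      ≤±′.[ η+diff≤η η (dot-mono-≤ λ′≥0 u≤u′) ]
    where
    u≤u′ : ∀ q → u q ≤ u′ q
    u≤u′ q = ≤±′.[≤]-injective (≤±-respˡ-≈ (v≈u q) (≤±-respʳ-≈ (w≈u′ q) (v≤w q)))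
    η+diff≤η : ∀ η {x y} → x ≤ y → η + (x - y) ≤ η
    η+diff≤η η {x} {y} x≤y = ≤-respʳ-≈ (+-identityʳ η)
      (+-monoʳ-≤ η (≤-respʳ-≈ (-‿inverseʳ y) (+-monoˡ-≤ (- y) x≤y)))

  F-mono : ∀ {v w} → IsReal v → IsReal w → v ≤𝓕 w → F v ≤𝓕 F w
  F-mono v-real w-real v≤w p = ⊔.⊔-mono-≤
    (sup±-mono λ i → F_i-mono i v-real w-real v≤w p) ≤±-refl

  F_i≤F : ∀ i w p → F_i i w p ≤± F w p
  F_i≤F i w p = ≤±-trans (x≤sup± (λ i → F_i i w p) i) (⊔.x≤x⊔y _ _)

  Xinᴿ≤F : ∀ w p → Xinᴿ p ≤± F w p
  Xinᴿ≤F w p = ⊔.x≤y⊔x (sup± λ i → F_i i w p) (Xinᴿ p)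

  nonpos : ∀ c {a} → a ⟦ c ⟧0 → a ≤ 0#
  nonpos lt = proj₁
  nonpos le = λ a≤0 → a≤0

  -- At a point of `Xin` the constraint values are nonpositive, strict or not, so evaluating any
  -- certificate leaves `0 ≤ η - p(x)`.
  Xinᴿ-lower : ∀ {x} → Member Xin x → ∀ p → [ eval (template p) x ] ≤± Xinᴿ p
  Xinᴿ-lower {x} x∈Xin p = inf-greatest _
    λ η (σ₀ , ν , σ₀-sos , ν-sos , _ , _ , eq) →
      let r = ⟨ ν , poly Xin ⟩
          q = const η -ₚ template p
      in ≤±′.[ 0≤y-x⇒x≤y (begin
        0#                                      ≤⟨ eval-SOS-nonneg σ₀ σ₀-sos x ⟩
        eval σ₀ x                               ≈⟨ eval-cong (q +ₚ r) σ₀ eq x ⟨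
        eval (q +ₚ r) x                         ≈⟨ eval-+ q r x ⟩
        eval q x + eval r x                     ≤⟨ +-monoʳ-≤ (eval q x)
          (eval-⟨⟩-nonpos ν (poly Xin) x ν-sos λ j →
            nonpos (compare Xin j) (x∈Xin j)) ⟩
        eval q x + 0#                           ≈⟨ +-identityʳ (eval q x) ⟩
        eval q x                                ≈⟨ eval-- (const η) (template p) x ⟩
        eval (const η) x - eval (template p) x  ≈⟨ +-congʳ (eval-const η x) ⟩
        η - eval (template p) x                 ∎) ]
    where open ≤-Reasoning

  -- The bound is independent of `w`: it bounds the whole sequence from below and keeps `F` finite
  -- at the limit.
  F-lower : ∀ w p → [ eval (template p) (proj₁ Xin-nonempty) ] ≤± F w p
  F-lower w p = ≤±-trans (Xinᴿ-lower (proj₂ Xin-nonempty) p) (Xinᴿ≤F w p)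

  -- One improvement step by a policy.

  module _ {w : 𝓕} {u : 𝓕ℝ} (w≈u : w ≈𝓕 embed u) (π : Policy) (w∈FS : FS w) where

    private
      λπ : I → P → 𝓕ℝ
      λπ i p = Multipliers.λ′ (proj₁ (π w w∈FS i p))

    -- The right-hand side has the shape of the bound in `F_i-transfer`, and its bracket vanishes at
    -- `w`; this gives `F_i≤φ` and `φ-self`.
    φ-real : ∀ i p {v u′} → v ≈𝓕 embed u′ → ((c , _) : ∃[ c ] F_i i w p ≡ [ c ]) →
             φ w i p (λπ i p) v ≈± [ c + (dot (λπ i p) u′ - dot (λπ i p) u) ]
    φ-real i p {v} {u′} v≈u′ (c , F≡c) = ≈±.trans
      (+±-cong-real
        (+±-cong-real (combine-real (λπ i p) v≈u′) (≈±.reflexive F≡c))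
        (-±-cong-real (combine-real (λπ i p) w≈u)))
      ≈±′.[ trans (+-congʳ (+-comm _ c)) (+-assoc c _ _) ]

    F_i≤φ : ∀ i p {v} → IsReal v → F_i i v p ≤± φ w i p (λπ i p) v
    F_i≤φ i p (u′ , v≈u′) with Sol-real w≈u (π w w∈FS i p)
    ... | c , F≡c , con = ≤±-respʳ-≈ (≈±.sym (φ-real i p v≈u′ (c , F≡c)))
      (F_i-transfer i p (proj₁ (π w w∈FS i p)) con v≈u′)

    φ-self : ∀ i p → φ w i p (λπ i p) w ≈± F_i i w p
    φ-self i p with Sol-real w≈u (π w w∈FS i p)
    ... | c , F≡c , _ = ≈±.trans (φ-real i p w≈u (c , F≡c)) (≈±.trans
      ≈±′.[ trans (+-congˡ (-‿inverseʳ _)) (+-identityʳ c) ]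
      (≈±.reflexive (≡.sym F≡c)))

    -- Arguments may take infinite values here, since Knaster-Tarski is applied on the whole lattice
    -- `𝓕`.
    φ-mono : ∀ i p {v v′} → v ≤𝓕 v′ → φ w i p (λπ i p) v ≤± φ w i p (λπ i p) v′
    φ-mono i p v≤v′ = +±-monoˡ _ (+±-monoˡ _ (sum±-mono λ q →
      ·±-mono (Multipliers.λ′≥0 (proj₁ (π w w∈FS i p)) q) (v≤v′ q)))

    Φ-mono : ∀ {v v′} → v ≤𝓕 v′ → Φ π w w∈FS v ≤𝓕 Φ π w w∈FS v′
    Φ-mono v≤v′ p = ⊔.⊔-mono-≤ (sup±-mono λ i → φ-mono i p v≤v′) ≤±-refl

    F≤Φ : ∀ {v} → IsReal v → F v ≤𝓕 Φ π w w∈FS v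
    F≤Φ v-real p = ⊔.⊔-mono-≤ (sup±-mono λ i → F_i≤φ i p v-real) ≤±-refl

    Φ-self≤F : Φ π w w∈FS w ≤𝓕 F w
    Φ-self≤F p = ⊔.⊔-mono-≤ (sup±-mono λ i → ≤±-reflexive (φ-self i p)) ≤±-refl

    improvement : F w ≤𝓕 w → ∀ {w′} → IsLeastFixpoint (Φ π w w∈FS) w′ →
                  IsReal w′ × F w′ ≤𝓕 w′ × w′ ≤𝓕 w × w′ ≤𝓕 F w
    improvement Fw≤w {w′} (Φw′≈w′ , least) = w′-real , Fw′≤w′ , w′≤w , w′≤Fw
      where
      open KnasterTarski (Φ π w w∈FS) Φ-mono
      -- Leastness compares `w′` with fixpoints only, and `w` is merely a post-fixpoint of `Φ`; the
      -- fixpoint `μf` lies between them.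
      w′≤w : w′ ≤𝓕 w
      w′≤w p = ≤±-trans (least μf μf-fixpoint p)
        (μf-lower (λ p → ≤±-trans (Φ-self≤F p) (Fw≤w p)) p)
      -- `Xinᴿ` is a term of the supremum defining `Φ` at `w′`, hence a lower bound of `w′`; the
      -- real function `w` bounds it above.
      w′-value : ∀ p → ∃[ x ] w′ p ≡ [ x ]
      w′-value p = bounded⇒real
        (≤±-trans (Xinᴿ-lower (proj₂ Xin-nonempty) p)
          (≤±-respʳ-≈ (Φw′≈w′ p)
            (⊔.x≤y⊔x (sup± λ i → φ w i p (λπ i p) w′) (Xinᴿ p))))
        (≤±-respʳ-≈ (w≈u p) (w′≤w p))
      w′-real : IsReal w′
      w′-real = proj₁ ∘ w′-value , ≈±.reflexive ∘ proj₂ ∘ w′-value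
      Fw′≤w′ : F w′ ≤𝓕 w′
      Fw′≤w′ p = ≤±-respʳ-≈ (Φw′≈w′ p) (F≤Φ w′-real p)
      -- The chain is `w′ ≈ Φ w′ ≤ Φ w ≤ F w`; it serves the fixpoint claim at the limit.
      w′≤Fw : w′ ≤𝓕 F w
      w′≤Fw p = ≤±-respˡ-≈ (Φw′≈w′ p) (≤±-trans (Φ-mono w′≤w p) (Φ-self≤F p))

  -- A run fixes its start and its stopped iterates only up to `≈𝓕`; monotonicity of `F`, applied to
  -- an equality read as an inequality, transports the invariant.
  post-fixpoint-cong : ∀ {v w} → IsReal w → v ≈𝓕 w → F w ≤𝓕 w →
                       IsReal v × F v ≤𝓕 v
  post-fixpoint-cong {v} {w} w-real@(u , w≈u) v≈w Fw≤w = v-real , λ p →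
    ≤±-trans (F-mono v-real w-real (≤±-reflexive ∘ v≈w) p)
             (≤±-respʳ-≈ (≈±.sym (v≈w p)) (Fw≤w p))
    where
    v-real : IsReal v
    v-real = u , λ p → ≈±.trans (v≈w p) (w≈u p)

  -- Invariants along a run.

  module Run {w⁰ : 𝓕ℝ} (Fw⁰≤w⁰ : F (embed w⁰) ≤𝓕 embed w⁰)
             {w : ℕ → 𝓕} (run : IsRun w⁰ w) where

    open IsRun run

    -- A stopped iterate repeats. Given `FS (w k)` it can only have stopped at a fixpoint, so the
    -- bound by `F (w k)` survives.
    step : ∀ k → IsReal (w k) → F (w k) ≤𝓕 w k →
      (IsReal (w (suc k)) × F (w (suc k)) ≤𝓕 w (suc k)) ×
      w (suc k) ≤𝓕 w k × (FS (w k) → w (suc k) ≤𝓕 F (w k))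
    step k wk-real@(u , wk≈u) Fwk≤wk with em {P = Stops (w k)}
    ... | no ¬stops =
      let w∈FS , π , lfp = improve k ¬stops
          real , post , ≤w , ≤Fw = improvement wk≈u π w∈FS Fwk≤wk lfp
      in (real , post) , ≤w , λ _ → ≤Fw
    ... | yes stops = post-fixpoint-cong wk-real same Fwk≤wk
                    , ≤±-reflexive ∘ same , ≤Fw stops
      where
      same : w (suc k) ≈𝓕 w k
      same = stop k stops (suc k) (ℕ.n≤1+n k)
      ≤Fw : Stops (w k) → FS (w k) → w (suc k) ≤𝓕 F (w k)
      ≤Fw (inj₁ fix)    _  p = ≤±-reflexive (≈±.trans (same p) (≈±.sym (fix p)))
      ≤Fw (inj₂ wk∉FS)  FS = contradiction FS wk∉FS

    invariant : ∀ k → IsReal (w k) × F (w k) ≤𝓕 w k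
    invariant zero    = post-fixpoint-cong (w⁰ , λ _ → ≈±.refl) start Fw⁰≤w⁰
    invariant (suc k) = let real , post = invariant k in proj₁ (step k real post)

    decreasing : ∀ k → w (suc k) ≤𝓕 w k
    decreasing k = let real , post = invariant k in proj₁ (proj₂ (step k real post))

    next≤F : ∀ k → FS (w k) → w (suc k) ≤𝓕 F (w k)
    next≤F k = let real , post = invariant k in proj₂ (proj₂ (step k real post))

    u : ℕ → 𝓕ℝ
    u k = proj₁ (proj₁ (invariant k))

    w≈u : ∀ k → w k ≈𝓕 embed (u k)
    w≈u k = proj₂ (proj₁ (invariant k))

    u-decreasing : ∀ p → Decreasing λ k → u k p
    u-decreasing p k = ≤±′.[≤]-injective
      (≤±-respˡ-≈ (w≈u (suc k) p) (≤±-respʳ-≈ (w≈u k p) (decreasing k p)))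

    u-lower : ∀ p k → eval (template p) (proj₁ Xin-nonempty) ≤ u k p
    u-lower p k = ≤±′.[≤]-injective (≤±-trans (F-lower (w k) p)
      (≤±-respʳ-≈ (w≈u k p) (proj₂ (invariant k) p)))

    u-limit : ∀ p → ∃ (Limit λ k → u k p)
    u-limit p = monotone-convergence (u-decreasing p) (u-lower p)

    converges : ∃[ l ] Converges w l
    converges = proj₁ ∘ u-limit , λ p ε 0<ε →
      let N , close = proj₂ (u-limit p) ε 0<ε in
      N , λ k N≤k → u k p , w≈u k p , close k N≤k

    -- Passage to the limit.

    module AtLimit {w∞ : 𝓕ℝ} (w→w∞ : Converges w w∞) where

      -- `Converges` brings its own real representative of `w k p`; it agrees with `u k p` up to
      -- `≈`, so the estimates carry over.
      u→w∞ : ∀ p → Limit (λ k → u k p) (w∞ p)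
      u→w∞ p ε 0<ε = let N , close = w→w∞ p ε 0<ε in N , λ k N≤k →
        let x , w≈x , x-l<ε , l-x<ε = close k N≤k
            x≈u = ≈±′.[≈]-injective (≈±.trans (≈±.sym w≈x) (w≈u k p))
        in <-respˡ-≈ (+-congʳ x≈u) x-l<ε , <-respˡ-≈ (+-congˡ (-‿cong x≈u)) l-x<ε

      w∞≤u : ∀ k p → w∞ p ≤ u k p
      w∞≤u k p = limit-lower (u-decreasing p) (u→w∞ p) k

      w∞≤w : ∀ k → embed w∞ ≤𝓕 w k
      w∞≤w k p = ≤±-respʳ-≈ (≈±.sym (w≈u k p)) ≤±′.[ w∞≤u k p ]

      w∞-real : IsReal (embed w∞)
      w∞-real = w∞ , λ _ → ≈±.refl

      -- Monotonicity gives `F w∞ ≤ F (w k) ≤ w k`, where the left end is constant in `k`; letting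
      -- `k` grow yields `post`.
      F-w∞≤w : ∀ k → F (embed w∞) ≤𝓕 w k
      F-w∞≤w k p = ≤±-trans (F-mono w∞-real (proj₁ (invariant k)) (w∞≤w k) p)
                            (proj₂ (invariant k) p)

      F-w∞-real : ∀ p → ∃[ c ] F (embed w∞) p ≡ [ c ]
      F-w∞-real p =
        bounded⇒real (F-lower (embed w∞) p) (≤±-respʳ-≈ (w≈u 0 p) (F-w∞≤w 0 p))

      post : F (embed w∞) ≤𝓕 embed w∞
      post p = let c , F≡c = F-w∞-real p in
        ≤±-respˡ-≈ (≈±.reflexive (≡.sym F≡c)) ≤±′.[ limit-greatest (u→w∞ p) (λ k →
          ≤±′.[≤]-injective
            (≤±-respˡ-≈ (≈±.reflexive F≡c) (≤±-respʳ-≈ (w≈u k p) (F-w∞≤w k p)))) ]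

      -- The multipliers at w∞ bound F (w k) p by F w∞ p + a·δ once w k is
      -- within δ of w∞, while w∞ ≤ w (suc k) ≤ F (w k).
      module _ (w∈FS : ∀ k → FS (w k)) (w∞∈FS : FS (embed w∞))
               (p : P) {c : ℝ} (F≡c : F (embed w∞) p ≡ [ c ]) where

        private
          λ∞ : I → 𝓕ℝ
          λ∞ i = Multipliers.λ′ (proj₁ (w∞∈FS i p))

          λ∞≥0 : ∀ i q → 0# ≤ λ∞ i q
          λ∞≥0 i = Multipliers.λ′≥0 (proj₁ (w∞∈FS i p))

          -- Summing over all regions gives one constant that serves every `i`, since each
          -- `sum (λ∞ i)` is at most `a`.
          a : ℝ
          a = sum (λ i → sum (λ∞ i))

          sum-λ∞≥0 : ∀ i → 0# ≤ sum (λ∞ i)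
          sum-λ∞≥0 i = sum-nonneg (λ∞≥0 i)

          0≤a : 0# ≤ a
          0≤a = sum-nonneg sum-λ∞≥0

        F-near : ∀ {δ} k → 0# ≤ δ → (∀ q → u k q - w∞ q ≤ δ) →
                 F (w k) p ≤± [ c + a * δ ]
        F-near {δ} k 0≤δ near = ⊔.⊔-lub (sup±-least _ F_i-near)
          (≤±-trans (Xinᴿ≤F (embed w∞) p) (≤±-respˡ-≈ (≈±.sym (≈±.reflexive F≡c))
            ≤±′.[ ≤-respˡ-≈ (+-identityʳ c) (+-monoʳ-≤ c (*-nonneg 0≤a 0≤δ)) ]))
          where
          F_i-near : ∀ i → F_i i (w k) p ≤± [ c + a * δ ]
          F_i-near i =
            let cᵢ , F_i≡cᵢ , con = Sol-real (proj₂ w∞-real) (w∞∈FS i p)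
                cᵢ≤c = ≤±′.[≤]-injective (≤±-respˡ-≈ (≈±.reflexive F_i≡cᵢ)
                  (≤±-respʳ-≈ (≈±.reflexive F≡c) (F_i≤F i (embed w∞) p)))
            in ≤±-trans (F_i-transfer i p (proj₁ (w∞∈FS i p)) con (w≈u k))
                        ≤±′.[ +-mono-≤ cᵢ≤c (dot-near i) ]
            where
            dot-near : ∀ i → dot (λ∞ i) (u k) - dot (λ∞ i) w∞ ≤ a * δ
            dot-near i = ≤-trans
              (x≤y+z⇒x-z≤y (dot-shift {a = λ∞ i} {u k} {w∞} {δ} (λ∞≥0 i)
                (λ q → x-z≤y⇒x≤y+z (near q))))
              (*-monoʳ-≤ 0≤δ (≤-sum sum-λ∞≥0 i))

        w∞≤c : w∞ p ≤ c
        w∞≤c with em {P = w∞ p ≤ c}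
        ... | yes w∞≤c = w∞≤c
        -- `δ` solves `δ + a * δ ≈ w∞ p - c`. Near the limit the excess `w∞ p - c` is at most
        -- `a * δ`, which forces `δ ≤ 0#`.
        ... | no w∞≰c with divide-1+nonneg 0≤a (x<y⇒0<y-x (≰⇒> w∞≰c))
        ...   | δ , 0<δ , δ+aδ≈ε with eventually-∀ (λ q → u→w∞ q δ 0<δ)
        ...     | N , close = contradiction δ≤0 (<⇒≱ 0<δ)
          where
          w∞≤c+aδ : w∞ p ≤ c + a * δ
          w∞≤c+aδ = ≤±′.[≤]-injective (≤±-trans (w∞≤w (suc N) p) (≤±-trans
            (next≤F N (w∈FS N) p)
            (F-near N (proj₁ 0<δ) (λ q → proj₁ (proj₁ (close N ℕ.≤-refl q))))))
          ε≤aδ : w∞ p - c ≤ a * δ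
          ε≤aδ = x≤y+z⇒x-z≤y (≤-respʳ-≈ (+-comm c (a * δ)) w∞≤c+aδ)
          δ≤0 : δ ≤ 0#
          δ≤0 = +-cancelʳ-≤ (a * δ) (≤-respˡ-≈ (sym δ+aδ≈ε)
            (≤-respʳ-≈ (sym (+-identityˡ (a * δ))) ε≤aδ))

      fixpoint : (∀ k → FS (w k)) → FS (embed w∞) → F (embed w∞) ≈𝓕 embed w∞
      fixpoint w∈FS w∞∈FS p = let c , F≡c = F-w∞-real p in ≤±-antisym (post p)
        (≤±-respʳ-≈ (≈±.reflexive (≡.sym F≡c)) ≤±′.[ w∞≤c w∈FS w∞∈FS p F≡c ])

theorem5p1 : (R : CompleteOrderedField) (em : ExcludedMiddle 0ℓ) →
    let open Analysis R em in
    (d m : ℕ) (sys : System d) (tpl : Templates d m) →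
    let open PolicyIteration sys tpl in
    (w⁰ : 𝓕ℝ) → F (embed w⁰) ≤𝓕 embed w⁰ →
    (w : ℕ → 𝓕) → IsRun w⁰ w →
    ((k : ℕ) → IsReal (w k) × F (w k) ≤𝓕 w k)
    × (((k : ℕ) → w (suc k) ≤𝓕 w k) × ∃[ l ] Converges w l)
    × ((w∞ : 𝓕ℝ) → Converges w w∞ →
    F (embed w∞) ≤𝓕 embed w∞
    × (((k : ℕ) → FS (w k)) → FS (embed w∞) → F (embed w∞) ≈𝓕 embed w∞))
theorem5p1 R em d m sys tpl w⁰ Fw⁰≤w⁰ w run =
  invariant , (decreasing , converges) , λ w∞ w→w∞ →
  let open AtLimit w→w∞ in post , fixpoint
  where
  open PolicyIterationProperties R em sys tpl
  open Run Fw⁰≤w⁰ run
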